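{- $\mu(n)=5$ for every $n\in\{13,14,15\}$.
   Context: A matroid on a finite set $S$ is a family $\mathcal{M}$ of subsets of $S$ with $\emptyset\in\mathcal{M}$, closed under subsets, such that for every $A\subseteq S$ all maximal members of $\mathcal{M}$ contained in $A$ have the same cardinality. For a finite simple graph $G=(V,E)$, $M(G)$ is the family of all matchings (sets of pairwise disjoint edges) of $G$, and $\mu(G)$ is the minimum $m\in\mathbb{N}$ such that $M(G)$ is the intersection $\mathcal{M}_1\cap\dots\cap\mathcal{M}_m$ of $m$ matroids on $E$. For $n\in\mathbb{N}$, $\mu(n)=\max\{\mu(G): G \text{ a finite simple graph with } |V|\le n\}$. -}

module Defs where

open import Data.Nat using (ℕ; _≤_; _<_)
open import Data.Bool using (Bool; true)
open import Data.Fin using (Fin)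
open import Data.Fin.Subset using (Subset; _∈_; _⊆_; ∣_∣) renaming (⊥ to ∅)
open import Data.Product using (Σ; _×_; ∃; ∃-syntax)
open import Relation.Binary.PropositionalEquality using (_≡_; _≢_)
open import Relation.Nullary using (¬_)
open import Function.Bundles using (_⇔_)

record Graph : Set where
  field
    nv  : ℕ
    ne  : ℕ
    src : Fin ne → Fin nv
    tgt : Fin ne → Fin nv
    loopless : ∀ e → src e ≢ tgt e
    simple   : ∀ e f → ((src e ≡ src f × tgt e ≡ tgt f) → e ≡ f)
                     × ((src e ≡ tgt f × tgt e ≡ src f) → e ≡ f)

open Graph public

Incident : (G : Graph) → Fin (nv G) → Fin (ne G) → Set
Incident G v e = (v ≡ src G e) Data.Sum.⊎ (v ≡ tgt G e)
  where import Data.Sum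

IsMatching : (G : Graph) → Subset (ne G) → Set
IsMatching G X = ∀ e f → e ∈ X → f ∈ X → e ≢ f →
                 ∀ v → ¬ (Incident G v e × Incident G v f)

-- A family of subsets of the finite set Fin m (given by its decidable
-- membership function; every family of subsets of a finite set is such).
Family : ℕ → Set
Family m = Subset m → Bool

_∈F_ : ∀ {m} → Subset m → Family m → Set
X ∈F F = F X ≡ true

MaximalIn : ∀ {m} → Family m → Subset m → Subset m → Set
MaximalIn F A X = X ⊆ A × X ∈F F × (∀ Z → X ⊆ Z → Z ⊆ A → Z ∈F F → Z ≡ X)

IsMatroid : ∀ {m} → Family m → Set
IsMatroid {m} F =
    (∅ ∈F F)
  × (∀ X Y → X ∈F F → Y ⊆ X → Y ∈F F)
  × (∀ (A X Y : Subset m) → MaximalIn F A X → MaximalIn F A Y → ∣ X ∣ ≡ ∣ Y ∣)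

IntersectionOf : (G : Graph) → ℕ → Set
IntersectionOf G k =
  Σ (Fin k → Family (ne G)) λ Ms →
    (∀ i → IsMatroid (Ms i))
  × (∀ X → IsMatching G X ⇔ (∀ i → X ∈F Ms i))

MuGraphIs : Graph → ℕ → Set
MuGraphIs G k = IntersectionOf G k × (∀ j → j < k → ¬ IntersectionOf G j)

MuIs : ℕ → ℕ → Set
MuIs n k =
    (∃[ G ] (nv G ≤ n × MuGraphIs G k))
  × (∀ G → nv G ≤ n → ∀ j → MuGraphIs G j → j ≤ k)

{-# OPTIONS --safe #-}
module Submission where

-- A matroid containing all matchings has no loops, and its parallel classes consist of
-- pairwise adjacent edges, so each class is a star or a triangle; conversely a partition
-- into stars is a partition matroid containing all matchings.  Hence k matroids amount to
-- k such partitions in which every two adjacent edges share a class at least once.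
--
-- With stars only, let A u v be the set of partitions in which the edge uv belongs to the
-- star at u.  Then A u v and A v u are disjoint, and the sets A u v, for fixed u, form an
-- intersecting family; assigning pairwise distinct maximal intersecting families on k
-- points to the vertices is all that is needed.  There are at least 15 of these for k = 5,
-- which gives the upper bound, and exactly 12 for k = 4.
--
-- For the lower bound, triangles have to be eliminated on n > 12 vertices and 4 partitions.
-- A triangle is needed at u if A u v and A u w are disjoint.  A triangle needed at no more
-- than one vertex can be turned into a star there, and a triangle u x y needed at x and y
-- can be recoloured if u takes part in another needed triangle.  When neither step applies,
-- greedy list colouring assigns distinct maximal intersecting families to all vertices: a
-- vertex u whose needed triangles contain h neighbours has more than h families compatible
-- with its other neighbours.

open import Defs
open import Data.Nat using (ℕ; _≤_)
open import Data.Bool using (Bool; true; false)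
import Data.Bool.Properties as Bool
open import Data.Empty using (⊥; ⊥-elim)
open import Data.Fin as Fin using (Fin; zero; suc; _≟_; splitAt; _↑ˡ_; _↑ʳ_; inject≤)
open import Data.Fin.Properties as Fin using (any?; all?; pigeonhole; ¬∀⟶∃¬; splitAt-↑ˡ; splitAt-↑ʳ; splitAt⁻¹-↑ˡ; splitAt⁻¹-↑ʳ; inject≤-injective)
open import Data.Fin.Subset using (Subset; inside; outside; _∈_; _∉_; _⊆_; _∪_; ∁; ∣_∣; Nonempty; ⁅_⁆) renaming (⊤ to full; ⊥ to ∅)
open import Data.Fin.Subset.Properties using (_∈?_; nonempty?; anySubset?; ∈⊤; ∉⊥; ⊆⊤; ⊆-antisym; p⊆p∪q; p⊂q⇒∣p∣<∣q∣; x∈p∪q⁻; x∈p∪q⁺; x∈∁p⇒x∉p; x∉p⇒x∈∁p; x∈⁅x⁆; x∈⁅y⁆⇒x≡y; ∣⁅x⁆∣≡1; ∣⊥∣≡0; ∪-comm; ∪-idem; ∪-identityˡ)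
open import Data.List as List using (List; []; _∷_; length; filter; allFin; cartesianProduct)
open import Data.List.Membership.Propositional using () renaming (_∈_ to _∈ˡ_; _∉_ to _∉ˡ_)
open import Data.List.Membership.Propositional.Properties using (∈-allFin; ∈-cartesianProduct⁺; ∈-filter⁻; ∈-lookup; ∈-map⁺)
open import Data.List.Properties using (length-map)
open import Data.List.Relation.Unary.All as All using (All; []; _∷_)
import Data.List.Relation.Unary.All.Properties as All
open import Data.List.Relation.Unary.AllPairs using ([]; _∷_)
open import Data.List.Relation.Unary.Any as Any using (here; there)
open import Data.List.Relation.Unary.Any.Properties using (lookup-index)
open import Data.List.Relation.Unary.Unique.Propositional using (Unique)
open import Data.List.Relation.Unary.Unique.Propositional.Properties using (filter⁺; allFin⁺)
open import Data.Nat as ℕ using (zero; suc; _+_; _<_; s≤s; z≤n)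
open import Data.Nat.Induction using (<-wellFounded)
import Data.Nat.Properties as ℕ
open import Data.Product using (_×_; _,_; ∃; ∃₂; proj₁; proj₂)
open import Data.Sum as Sum using (_⊎_; inj₁; inj₂)
open import Data.Vec using (Vec; []; _∷_; here; there; lookup; tabulate)
open import Data.Vec.Properties as Vec using (lookup∘tabulate; lookup⇒[]=; []=⇒lookup)
open import Function using (_∘_; mk⇔; Equivalence)
open import Induction.WellFounded using (Acc; acc)
open import Relation.Binary using (tri<; tri≈; tri>)
open import Relation.Binary.PropositionalEquality using (_≡_; _≢_; refl; sym; trans; cong; subst; ≢-sym)
open import Relation.Nullary using (¬_; Dec; yes; no; does)
open import Relation.Nullary.Decidable using (map′; _×-dec_; _⊎-dec_; _→-dec_; ¬?; decidable-stable; dec-true; toWitness)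

-- Disjointness, and decidable quantification over subsets

Meets : ∀ {n} → Subset n → Subset n → Set
Meets X Y = ∃ λ c → c ∈ X × c ∈ Y

-- A record, so that the sets can be inferred from a proof of disjointness.
record Disj {n} (X Y : Subset n) : Set where
  constructor disj
  field apart : ∀ {c} → c ∈ X → c ∉ Y
open Disj public

record Single {n} (X : Subset n) : Set where
  constructor single
  field card : ∣ X ∣ ≡ 1

Meets? : ∀ {n} (X Y : Subset n) → Dec (Meets X Y)
Meets? X Y = any? λ c → c ∈? X ×-dec c ∈? Y

Disj? : ∀ {n} (X Y : Subset n) → Dec (Disj X Y)
Disj? X Y = map′ (λ ¬m → disj λ p q → ¬m (_ , p , q)) (λ { d (_ , p , q) → apart d p q }) (¬? (Meets? X Y))

Single? : ∀ {n} (X : Subset n) → Dec (Single X)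
Single? X = map′ single Single.card (∣ X ∣ ℕ.≟ 1)

_≟ˢ_ : ∀ {n} (X Y : Subset n) → Dec (X ≡ Y)
_≟ˢ_ = Vec.≡-dec Bool._≟_

Meets-or-Disj : ∀ {n} (X Y : Subset n) → Meets X Y ⊎ Disj X Y
Meets-or-Disj X Y with Meets? X Y
... | yes m = inj₁ m
... | no ¬m = inj₂ (disj λ p q → ¬m (_ , p , q))

Meets-sym : ∀ {n} {X Y : Subset n} → Meets X Y → Meets Y X
Meets-sym (c , p , q) = c , q , p

Disj-sym : ∀ {n} {X Y : Subset n} → Disj X Y → Disj Y X
Disj-sym d = disj λ p q → apart d q p

Meets-¬Disj : ∀ {n} {X Y : Subset n} → Meets X Y → Disj X Y → ⊥
Meets-¬Disj (_ , p , q) d = apart d p q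

∀⊆? : ∀ {n} {P : Subset n → Set} → (∀ X → Dec (P X)) → Dec (∀ X → P X)
∀⊆? {zero} P? = map′ (λ { p [] → p }) (λ f → f []) (P? [])
∀⊆? {suc n} P? =
  map′ (λ { (f , g) (inside ∷ X) → f X ; (f , g) (outside ∷ X) → g X })
       (λ f → f ∘ (inside ∷_) , f ∘ (outside ∷_))
       (∀⊆? (P? ∘ (inside ∷_)) ×-dec ∀⊆? (P? ∘ (outside ∷_)))

-- Facts about sets of four colours

Mask : Set
Mask = Subset 4

private
  no? : Dec ⊥
  no? = no λ ()

-- The statements about a bounded number of masks are decided by enumeration; abstract keeps
-- the enumerations from being unfolded again at every use.
abstract
  single-disj : ∀ (p : Mask) → Single p → ∀ Y → Meets p Y → ∀ Z → Disj Y Z → Disj p Z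
  single-disj = toWitness {a? = ∀⊆? λ p → Single? p →-dec ∀⊆? λ Y → Meets? p Y →-dec
    ∀⊆? λ Z → Disj? Y Z →-dec Disj? p Z} _

  single-unique : ∀ (p : Mask) → Single p → ∀ q → Single q → Meets p q → p ≡ q
  single-unique = toWitness {a? = ∀⊆? λ p → Single? p →-dec ∀⊆? λ q → Single? q →-dec
    Meets? p q →-dec p ≟ˢ q} _

  four-disjoint : ∀ (X : Mask) → Nonempty X → ∀ Y → Nonempty Y → Disj X Y →
    ∀ Z → Nonempty Z → Disj X Z → Disj Y Z →
    ∀ W → Nonempty W → Disj X W → Disj Y W → Disj Z W → Single X
  four-disjoint = toWitness {a? =
    ∀⊆? λ X → nonempty? X →-dec ∀⊆? λ Y → nonempty? Y →-dec Disj? X Y →-dec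
    ∀⊆? λ Z → nonempty? Z →-dec Disj? X Z →-dec Disj? Y Z →-dec
    ∀⊆? λ W → nonempty? W →-dec Disj? X W →-dec Disj? Y W →-dec Disj? Z W →-dec Single? X} _

  five-disjoint : ∀ (X : Mask) → Nonempty X → ∀ Y → Nonempty Y → Disj X Y →
    ∀ Z → Nonempty Z → Disj X Z → Disj Y Z →
    ∀ W → Nonempty W → Disj X W → Disj Y W → Disj Z W →
    ∀ V → Nonempty V → Disj X V → Disj Y V → Disj Z V → Disj W V → ⊥
  five-disjoint = toWitness {a? =
    ∀⊆? λ X → nonempty? X →-dec ∀⊆? λ Y → nonempty? Y →-dec Disj? X Y →-dec
    ∀⊆? λ Z → nonempty? Z →-dec Disj? X Z →-dec Disj? Y Z →-dec
    ∀⊆? λ W → nonempty? W →-dec Disj? X W →-dec Disj? Y W →-dec Disj? Z W →-dec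
    ∀⊆? λ V → nonempty? V →-dec Disj? X V →-dec Disj? Y V →-dec Disj? Z V →-dec Disj? W V →-dec no?} _

  complement-exhausts : ∀ (p τ Y : Mask) → Disj Y p → Disj Y τ → Disj Y (∁ (p ∪ τ)) → ¬ Nonempty Y
  complement-exhausts = toWitness {a? = ∀⊆? λ p → ∀⊆? λ τ → ∀⊆? λ Y → Disj? Y p →-dec Disj? Y τ →-dec
    Disj? Y (∁ (p ∪ τ)) →-dec ¬? (nonempty? Y)} _

  -- The disjoint `S` and `S'` force two points into `a`, which leaves one each for `p` and `τ`.
  tight : ∀ (a p : Mask) → Nonempty p → Disj a p → ∀ τ → Nonempty τ → Disj τ a → Disj τ p →
    ∀ S → Meets a S → ∀ S' → Meets a S' → Disj S S' →
    Single p × Single τ × a ≡ ∁ (p ∪ τ)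
  tight = toWitness {a? = ∀⊆? λ a → ∀⊆? λ p → nonempty? p →-dec Disj? a p →-dec
    ∀⊆? λ τ → nonempty? τ →-dec Disj? τ a →-dec Disj? τ p →-dec
    ∀⊆? λ S → Meets? a S →-dec ∀⊆? λ S' → Meets? a S' →-dec Disj? S S' →-dec
    (Single? p ×-dec Single? τ ×-dec a ≟ˢ ∁ (p ∪ τ))} _

  -- `Z` lies in `p ∪ U` and `t` avoids `U`, so the two can only meet in `p`.
  escape : ∀ (p : Mask) → Single p → ∀ U t → Disj t U → ∀ Z → Meets t Z → Disj (∁ (p ∪ U)) Z →
    Meets p t × Meets p Z
  escape = toWitness {a? = ∀⊆? λ p → Single? p →-dec ∀⊆? λ U → ∀⊆? λ t → Disj? t U →-dec
    ∀⊆? λ Z → Meets? t Z →-dec Disj? (∁ (p ∪ U)) Z →-dec (Meets? p t ×-dec Meets? p Z)} _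

  escape-other : ∀ (p : Mask) → Single p → ∀ m → Disj p m → ∀ Z → Meets m Z →
    ∀ U → Disj (∁ (p ∪ U)) Z → Meets U m
  escape-other = toWitness {a? = ∀⊆? λ p → Single? p →-dec ∀⊆? λ m → Disj? p m →-dec
    ∀⊆? λ Z → Meets? m Z →-dec ∀⊆? λ U → Disj? (∁ (p ∪ U)) Z →-dec Meets? U m} _

  -- Outside `p` and `τ` there are two points, at least one of them in `b`. So `m` has at most one
  -- point and cannot meet both of the disjoint sets `υ` and `Q`.
  crowded : ∀ (p : Mask) → Single p → ∀ τ → Single τ → Disj τ p → ∀ m → Disj p m → Disj τ m →
    ∀ b → Disj b m → Meets (∁ (p ∪ τ)) b → ∀ υ → Meets υ m → ∀ Q → Disj υ Q → Meets Q m → ⊥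
  crowded = toWitness {a? = ∀⊆? λ p → Single? p →-dec ∀⊆? λ τ → Single? τ →-dec Disj? τ p →-dec
    ∀⊆? λ m → Disj? p m →-dec Disj? τ m →-dec ∀⊆? λ b → Disj? b m →-dec Meets? (∁ (p ∪ τ)) b →-dec
    ∀⊆? λ υ → Meets? υ m →-dec ∀⊆? λ Q → Disj? υ Q →-dec Meets? Q m →-dec no?} _

  -- `m` and `b` share out the two points outside `p` and `τ`; only `p` is left for `κ`.
  last-colour : ∀ (p : Mask) → Single p → ∀ τ → Single τ → Disj τ p →
    ∀ m → Nonempty m → Disj p m → Disj τ m →
    ∀ b → Disj b m → Disj τ b → Meets (∁ (p ∪ τ)) b →
    ∀ κ → Nonempty κ → Disj κ τ → Disj κ m → Disj κ b → κ ≡ p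
  last-colour = toWitness {a? = ∀⊆? λ p → Single? p →-dec ∀⊆? λ τ → Single? τ →-dec Disj? τ p →-dec
    ∀⊆? λ m → nonempty? m →-dec Disj? p m →-dec Disj? τ m →-dec
    ∀⊆? λ b → Disj? b m →-dec Disj? τ b →-dec Meets? (∁ (p ∪ τ)) b →-dec
    ∀⊆? λ κ → nonempty? κ →-dec Disj? κ τ →-dec Disj? κ m →-dec Disj? κ b →-dec κ ≟ˢ p} _

  fourth-colour : ∀ (X : Mask) → Single X → ∀ Y → Single Y → Disj X Y → ∀ Z → Single Z → Disj X Z → Disj Y Z →
    ∀ S → Meets X S → Meets Y S → Meets Z S → ∀ B → Nonempty B → Disj S B →
    Single B × B ≡ ∁ (X ∪ Y ∪ Z) × (∀ W → Disj W S → Disj W B → ¬ Nonempty W)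
  fourth-colour = toWitness {a? = ∀⊆? λ X → Single? X →-dec ∀⊆? λ Y → Single? Y →-dec Disj? X Y →-dec
    ∀⊆? λ Z → Single? Z →-dec Disj? X Z →-dec Disj? Y Z →-dec
    ∀⊆? λ S → Meets? X S →-dec Meets? Y S →-dec Meets? Z S →-dec
    ∀⊆? λ B → nonempty? B →-dec Disj? S B →-dec
    (Single? B ×-dec B ≟ˢ ∁ (X ∪ Y ∪ Z) ×-dec ∀⊆? λ W → Disj? W S →-dec Disj? W B →-dec ¬? (nonempty? W))} _

-- Maximal intersecting families on four points

weigh : ∀ {n} → Vec ℕ n → Subset n → ℕ
weigh [] [] = 0
weigh (w ∷ ws) (inside ∷ X) = w + weigh ws X
weigh (w ∷ ws) (outside ∷ X) = weigh ws X

Wins : ∀ {n} → Vec ℕ n → Subset n → Set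
Wins w X = weigh w (∁ X) < weigh w X

Wins? : ∀ {n} (w : Vec ℕ n) (X : Subset n) → Dec (Wins w X)
Wins? w X = weigh w (∁ X) ℕ.<? weigh w X

-- All twelve maximal intersecting families on four points are given by weighted majorities.
weights : Vec (Vec ℕ 4) 12
weights =
  (1 ∷ 0 ∷ 0 ∷ 0 ∷ []) ∷ (0 ∷ 1 ∷ 0 ∷ 0 ∷ []) ∷ (0 ∷ 0 ∷ 1 ∷ 0 ∷ []) ∷ (0 ∷ 0 ∷ 0 ∷ 1 ∷ []) ∷
  (0 ∷ 1 ∷ 1 ∷ 1 ∷ []) ∷ (1 ∷ 0 ∷ 1 ∷ 1 ∷ []) ∷ (1 ∷ 1 ∷ 0 ∷ 1 ∷ []) ∷ (1 ∷ 1 ∷ 1 ∷ 0 ∷ []) ∷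
  (2 ∷ 1 ∷ 1 ∷ 1 ∷ []) ∷ (1 ∷ 2 ∷ 1 ∷ 1 ∷ []) ∷ (1 ∷ 1 ∷ 2 ∷ 1 ∷ []) ∷ (1 ∷ 1 ∷ 1 ∷ 2 ∷ []) ∷ []

record Mem (f : Fin 12) (X : Mask) : Set where
  constructor mem
  field wins : Wins (lookup weights f) X

Mem? : ∀ f X → Dec (Mem f X)
Mem? f X = map′ mem Mem.wins (Wins? (lookup weights f) X)

abstract
  -- Two disjoint sets cannot both outweigh their complements.
  Mem-meets : ∀ f X → Mem f X → ∀ Y → Mem f Y → Meets X Y
  Mem-meets = toWitness {a? = all? λ f → ∀⊆? λ X → Mem? f X →-dec ∀⊆? λ Y → Mem? f Y →-dec Meets? X Y} _

Forced : List Mask → Fin 12 → Set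
Forced Ss f = ∀ X → All (Meets X) Ss → Mem f X

Forced? : ∀ Ss f → Dec (Forced Ss f)
Forced? Ss f = ∀⊆? λ X → All.all? (Meets? X) Ss →-dec Mem? f X

candidates : List Mask → List (Fin 12)
candidates Ss = filter (Forced? Ss) (allFin 12)

abstract
  -- This bound and the next two exceed the number of conflicting vertices in the shapes that a
  -- `Core` can have: two for an edge, three for a cherry, four for a path.
  candidates₂ : ∀ (S : Mask) → Nonempty S → ∀ S' → Nonempty S' → Disj S S' →
    ∀ κ → Nonempty κ → Disj κ S → Disj κ S' → 2 < length (candidates (S ∷ S' ∷ []))
  candidates₂ = toWitness {a? = ∀⊆? λ S → nonempty? S →-dec ∀⊆? λ S' → nonempty? S' →-dec Disj? S S' →-dec
    ∀⊆? λ κ → nonempty? κ →-dec Disj? κ S →-dec Disj? κ S' →-dec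
    2 ℕ.<? length (candidates (S ∷ S' ∷ []))} _

  candidates₃ : ∀ (S : Mask) → Single S → ∀ κ → Nonempty κ → Disj κ S → ∀ κ' → Nonempty κ' → Disj κ' S → Disj κ κ' →
    ∀ P → Disj S P → Disj κ P → ∀ Q → Disj S Q → Disj κ' Q → Meets P Q →
    3 < length (candidates (S ∷ P ∷ Q ∷ []))
  candidates₃ = toWitness {a? = ∀⊆? λ S → Single? S →-dec ∀⊆? λ κ → nonempty? κ →-dec Disj? κ S →-dec
    ∀⊆? λ κ' → nonempty? κ' →-dec Disj? κ' S →-dec Disj? κ κ' →-dec
    ∀⊆? λ P → Disj? S P →-dec Disj? κ P →-dec ∀⊆? λ Q → Disj? S Q →-dec Disj? κ' Q →-dec Meets? P Q →-dec
    3 ℕ.<? length (candidates (S ∷ P ∷ Q ∷ []))} _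

  candidates₄ : ∀ (S : Mask) → Single S → ∀ S' → Single S' → Disj S S' → 4 < length (candidates (S ∷ S' ∷ []))
  candidates₄ = toWitness {a? = ∀⊆? λ S → Single? S →-dec ∀⊆? λ S' → Single? S' →-dec Disj? S S' →-dec
    4 ℕ.<? length (candidates (S ∷ S' ∷ []))} _

  dictator : ∀ (S : Mask) → Single S → ∃ λ f → ∀ X → Meets S X → Mem f X
  dictator = toWitness {a? = ∀⊆? λ S → Single? S →-dec any? λ f → ∀⊆? λ X → Meets? S X →-dec Mem? f X} _

-- A maximal intersecting family without singletons is determined by which one of each pair
-- of complementary two-element sets it contains.
halves : Fin 3 → Bool → Mask
halves zero true = inside ∷ inside ∷ outside ∷ outside ∷ []
halves zero false = outside ∷ outside ∷ inside ∷ inside ∷ []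
halves (suc zero) true = inside ∷ outside ∷ inside ∷ outside ∷ []
halves (suc zero) false = outside ∷ inside ∷ outside ∷ inside ∷ []
halves (suc (suc zero)) true = inside ∷ outside ∷ outside ∷ inside ∷ []
halves (suc (suc zero)) false = outside ∷ inside ∷ inside ∷ outside ∷ []

abstract
  halves-complement : ∀ i X → Nonempty X → ¬ Single X → X ≡ halves i false ⊎ Meets X (halves i true)
  halves-complement = toWitness {a? = all? λ i → ∀⊆? λ X → nonempty? X →-dec ¬? (Single? X) →-dec
    (X ≟ˢ halves i false ⊎-dec Meets? X (halves i true))} _

  -- Halves chosen from different pairs always meet. The three of them either share a point, as for
  -- the weights with a 2, or lie within three points, as for the majorities of three.
  nondictator : ∀ (β : Vec Bool 3) → ∃ λ f → ∀ X → ¬ Single X →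
    (∀ i → Meets X (halves i (lookup β i))) → Mem f X
  nondictator = toWitness {a? = ∀⊆? λ β → any? λ f → ∀⊆? λ X → ¬? (Single? X) →-dec
    (all? λ i → Meets? X (halves i (lookup β i))) →-dec Mem? f X} _

  two-in-three : ∀ (S : Mask) → Nonempty S → ∀ S' → Nonempty S' → Disj S S' →
    ∀ κ → Nonempty κ → Disj κ S → Disj κ S' → Single S ⊎ Single S'
  two-in-three = toWitness {a? = ∀⊆? λ S → nonempty? S →-dec ∀⊆? λ S' → nonempty? S' →-dec Disj? S S' →-dec
    ∀⊆? λ κ → nonempty? κ →-dec Disj? κ S →-dec Disj? κ S' →-dec (Single? S ⊎-dec Single? S')} _

-- Pigeonhole on lists; configurations of stars and triangles

∈ˡ? : ∀ {n} (z : Fin n) xs → Dec (z ∈ˡ xs)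
∈ˡ? z = Any.any? (z ≟_)

exhaustive⇒long : ∀ {n} (xs : List (Fin n)) → (∀ z → z ∈ˡ xs) → n ≤ length xs
exhaustive⇒long xs all = ℕ.≮⇒≥ λ lt → let i , j , i<j , eq = pigeonhole lt (Any.index ∘ all) in
  Fin.<⇒≢ i<j (trans (lookup-index (all i)) (trans (cong (List.lookup xs) eq) (sym (lookup-index (all j)))))

fresh : ∀ {n} (xs : List (Fin n)) → length xs < n → ∃ λ z → z ∉ˡ xs
fresh xs lt with any? (λ z → ¬? (∈ˡ? z xs))
... | yes r = r
... | no ¬r = ⊥-elim (ℕ.<⇒≱ lt (exhaustive⇒long xs λ z → decidable-stable (∈ˡ? z xs) λ ¬p → ¬r (z , ¬p)))

-- A u v collects the partitions whose class of uv is a star centred at u, and Tr u v w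
-- those in which uvw is a class.
record Config (n : ℕ) : Set where
  field
    A : Fin n → Fin n → Mask
    Tr : Fin n → Fin n → Fin n → Mask
    -- A default value: the full set meets every nonempty set, so a vertex never conflicts with
    -- itself.
    A-diag : ∀ u → A u u ≡ full
    A-disj : ∀ {u v} → u ≢ v → Disj (A u v) (A v u)
    Tr-swap : ∀ u v w → Tr u v w ≡ Tr v u w
    Tr-flip : ∀ u v w → Tr u v w ≡ Tr u w v
    Tr-≢ : ∀ {u v w} → Nonempty (Tr u v w) → u ≢ v
    Tr-A : ∀ u v w → Disj (Tr u v w) (A u v)
    Tr-unique : ∀ u v {w w'} → w ≢ w' → Disj (Tr u v w) (Tr u v w')
    cover : ∀ {u v w} → u ≢ v → u ≢ w → v ≢ w → Meets (A u v) (A u w) ⊎ Nonempty (Tr u v w)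

-- Triangle count and local surgery on a configuration

triples : ∀ n → List (Fin n × Fin n × Fin n)
triples n = cartesianProduct (allFin n) (cartesianProduct (allFin n) (allFin n))

module _ {X : Set} where

  count : {P : X → Set} → (∀ x → Dec (P x)) → List X → ℕ
  count P? xs = length (filter P? xs)

  count-≤ : {P Q : X → Set} (P? : ∀ x → Dec (P x)) (Q? : ∀ x → Dec (Q x)) → (∀ x → P x → Q x) →
    ∀ xs → count P? xs ≤ count Q? xs
  count-≤ P? Q? P⊆Q [] = z≤n
  count-≤ P? Q? P⊆Q (x ∷ xs) with P? x | Q? x
  ... | yes p | yes q = s≤s (count-≤ P? Q? P⊆Q xs)
  ... | yes p | no ¬q = ⊥-elim (¬q (P⊆Q x p))
  ... | no ¬p | yes q = ℕ.m≤n⇒m≤1+n (count-≤ P? Q? P⊆Q xs)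
  ... | no ¬p | no ¬q = count-≤ P? Q? P⊆Q xs

  count-< : {P Q : X → Set} (P? : ∀ x → Dec (P x)) (Q? : ∀ x → Dec (Q x)) → (∀ x → P x → Q x) →
    ∀ {x} xs → x ∈ˡ xs → Q x → ¬ P x → count P? xs < count Q? xs
  count-< P? Q? P⊆Q (x ∷ xs) (here refl) qx ¬px with P? x | Q? x
  ... | yes p | _ = ⊥-elim (¬px p)
  ... | no ¬p | yes q = s≤s (count-≤ P? Q? P⊆Q xs)
  ... | no ¬p | no ¬q = ⊥-elim (¬q qx)
  count-< P? Q? P⊆Q (x ∷ xs) (there i) qx ¬px with P? x | Q? x
  ... | yes p | yes q = s≤s (count-< P? Q? P⊆Q xs i qx ¬px)
  ... | yes p | no ¬q = ⊥-elim (¬q (P⊆Q x p))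
  ... | no ¬p | yes q = ℕ.m≤n⇒m≤1+n (count-< P? Q? P⊆Q xs i qx ¬px)
  ... | no ¬p | no ¬q = count-< P? Q? P⊆Q xs i qx ¬px

-- The termination measure. A triangle counts once for each order of its vertices, however many
-- colours it has.
triangles : ∀ {n} → Config n → ℕ
triangles {n} C = count (λ (u , v , w) → nonempty? (Config.Tr C u v w)) (triples n)

-- Surgery on three vertices: `g` replaces the sets on the edges among them, and the triangle on
-- them is deleted. Nothing else changes, so the axioms reduce to conditions on `g` within the three
-- vertices and against one outside vertex `q`.
module Replace {n : ℕ} (C : Config n) (t : Fin 3 → Fin n) (t-inj : ∀ {i j} → t i ≡ t j → i ≡ j)
  (g : Fin 3 → Fin 3 → Mask) where
  open Config C

  Outside : Fin n → Set
  Outside q = ∀ i → t i ≢ q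

  locate : ∀ a → Dec (∃ λ i → t i ≡ a)
  locate a = any? λ i → t i ≟ a

  A′ : Fin n → Fin n → Mask
  A′ a b with locate a | locate b
  ... | yes (i , _) | yes (j , _) = g i j
  ... | _ | _ = A a b

  Tr′ : Fin n → Fin n → Fin n → Mask
  Tr′ a b c with locate a | locate b | locate c
  ... | yes _ | yes _ | yes _ = ∅
  ... | _ | _ | _ = Tr a b c

  Tr′⊆Tr : ∀ a b c → Nonempty (Tr′ a b c) → Nonempty (Tr a b c)
  Tr′⊆Tr a b c ne with locate a | locate b | locate c
  ... | yes _ | yes _ | yes _ = ⊥-elim (∉⊥ (proj₂ ne))
  ... | yes _ | yes _ | no _ = ne
  ... | yes _ | no _ | _ = ne
  ... | no _ | _ | _ = ne

  Tr′-removed : ∀ i j k → ¬ Nonempty (Tr′ (t i) (t j) (t k))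
  Tr′-removed i j k ne with locate (t i) | locate (t j) | locate (t k)
  ... | yes _ | yes _ | yes _ = ∉⊥ (proj₂ ne)
  ... | yes _ | yes _ | no ¬p = ¬p (k , refl)
  ... | yes _ | no ¬p | _ = ¬p (j , refl)
  ... | no ¬p | _ | _ = ¬p (i , refl)

  ∅-disj : ∀ {X} → Disj {4} ∅ X
  ∅-disj = disj λ p _ → ∉⊥ p

  module _
    (g-diag : ∀ i → g i i ≡ full)
    (g-disj : ∀ {i j} → i ≢ j → Disj (g i j) (g j i))
    (g-Tr : ∀ {i j} → i ≢ j → ∀ {q} → Outside q → Disj (Tr (t i) (t j) q) (g i j))
    (g-meets : ∀ {i j k} → i ≢ j → i ≢ k → j ≢ k → Meets (g i j) (g i k))
    (g-cover : ∀ {i j} → i ≢ j → ∀ {q} → Outside q → Meets (g i j) (A (t i) q) ⊎ Nonempty (Tr (t i) (t j) q))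
    where

    private
      diag : ∀ u → A′ u u ≡ full
      diag u with locate u
      ... | yes (i , _) = g-diag i
      ... | no _ = A-diag u

      disjoint : ∀ {u v} → u ≢ v → Disj (A′ u v) (A′ v u)
      disjoint {u} {v} u≢v with locate u | locate v
      ... | yes (i , refl) | yes (j , refl) = g-disj λ { refl → u≢v refl }
      ... | yes _ | no _ = A-disj u≢v
      ... | no _ | yes _ = A-disj u≢v
      ... | no _ | no _ = A-disj u≢v

      swap : ∀ u v w → Tr′ u v w ≡ Tr′ v u w
      swap u v w with locate u | locate v | locate w
      ... | yes _ | yes _ | yes _ = refl
      ... | yes _ | yes _ | no _ = Tr-swap u v w
      ... | yes _ | no _ | _ = Tr-swap u v w
      ... | no _ | yes _ | _ = Tr-swap u v w
      ... | no _ | no _ | _ = Tr-swap u v w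

      flip : ∀ u v w → Tr′ u v w ≡ Tr′ u w v
      flip u v w with locate u | locate v | locate w
      ... | yes _ | yes _ | yes _ = refl
      ... | yes _ | yes _ | no _ = Tr-flip u v w
      ... | yes _ | no _ | yes _ = Tr-flip u v w
      ... | yes _ | no _ | no _ = Tr-flip u v w
      ... | no _ | _ | _ = Tr-flip u v w

      Tr′-A′ : ∀ u v w → Disj (Tr′ u v w) (A′ u v)
      Tr′-A′ u v w with locate u | locate v | locate w
      ... | yes _ | yes _ | yes _ = ∅-disj
      ... | yes (i , refl) | yes (j , refl) | no ¬w with i ≟ j
      ...   | yes refl = disj λ p _ → Tr-≢ (_ , p) refl
      ...   | no i≢j = g-Tr i≢j λ k e → ¬w (k , e)
      Tr′-A′ u v w | yes _ | no _ | _ = Tr-A u v w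
      Tr′-A′ u v w | no _ | _ | _ = Tr-A u v w

      unique : ∀ u v {w w'} → w ≢ w' → Disj (Tr′ u v w) (Tr′ u v w')
      unique u v {w} {w'} ne with locate u | locate v | locate w | locate w'
      ... | yes _ | yes _ | yes _ | _ = ∅-disj
      ... | yes _ | yes _ | no _ | yes _ = Disj-sym ∅-disj
      ... | yes _ | yes _ | no _ | no _ = Tr-unique u v ne
      ... | yes _ | no _ | _ | _ = Tr-unique u v ne
      ... | no _ | _ | _ | _ = Tr-unique u v ne

      covers : ∀ {u v w} → u ≢ v → u ≢ w → v ≢ w → Meets (A′ u v) (A′ u w) ⊎ Nonempty (Tr′ u v w)
      covers {u} {v} {w} u≢v u≢w v≢w with locate u | locate v | locate w
      ... | yes (i , refl) | yes (j , refl) | yes (k , refl) =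
        inj₁ (g-meets (λ { refl → u≢v refl }) (λ { refl → u≢w refl }) (λ { refl → v≢w refl }))
      ... | yes (i , refl) | yes (j , refl) | no ¬w = g-cover (λ { refl → u≢v refl }) λ k e → ¬w (k , e)
      ... | yes (i , refl) | no ¬v | yes (k , refl)
        with g-cover {i} {k} (λ { refl → u≢w refl }) (λ j e → ¬v (j , e))
      ...   | inj₁ m = inj₁ (Meets-sym m)
      ...   | inj₂ ne = inj₂ (subst Nonempty (Tr-flip _ _ _) ne)
      covers u≢v u≢w v≢w | yes _ | no _ | no _ = cover u≢v u≢w v≢w
      covers u≢v u≢w v≢w | no _ | _ | _ = cover u≢v u≢w v≢w

    config : Config n
    config = record
      { A = A′ ; Tr = Tr′ ; A-diag = diag ; A-disj = disjoint ; Tr-swap = swap ; Tr-flip = flip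
      ; Tr-≢ = λ {u} {v} {w} ne → Tr-≢ (Tr′⊆Tr u v w ne)
      ; Tr-A = Tr′-A′ ; Tr-unique = unique ; cover = covers }

    fewer : ∀ i j k → Nonempty (Tr (t i) (t j) (t k)) → triangles config < triangles C
    fewer i j k ne = count-< _ _ (λ (u , v , w) → Tr′⊆Tr u v w) (triples n)
      (∈-cartesianProduct⁺ (∈-allFin _) (∈-cartesianProduct⁺ (∈-allFin _) (∈-allFin _)))
      ne (Tr′-removed i j k)

-- Comprehensions, choice from lists, case analysis on three vertices

does⁻ : ∀ {P : Set} (P? : Dec P) → does P? ≡ true → P
does⁻ (yes p) _ = p

⟦_⟧ : ∀ {n} {P : Fin n → Set} → (∀ c → Dec (P c)) → Subset n
⟦ P? ⟧ = tabulate (does ∘ P?)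

module _ {n : ℕ} {P : Fin n → Set} (P? : ∀ c → Dec (P c)) where

  ∈⟦⟧⁺ : ∀ {c} → P c → c ∈ ⟦ P? ⟧
  ∈⟦⟧⁺ {c} p = lookup⇒[]= c _ (trans (lookup∘tabulate _ c) (dec-true (P? c) p))

  ∈⟦⟧⁻ : ∀ {c} → c ∈ ⟦ P? ⟧ → P c
  ∈⟦⟧⁻ {c} m = does⁻ (P? c) (trans (sym (lookup∘tabulate (does ∘ P?) c)) ([]=⇒lookup m))

module _ {n : ℕ} {X Y Z : Subset n} where

  Disj-∪ : Disj X Z → Disj Y Z → Disj (X ∪ Y) Z
  Disj-∪ d e = disj λ p q → case-∪ (x∈p∪q⁻ X Y p) q
    where
    case-∪ : ∀ {c} → c ∈ X ⊎ c ∈ Y → c ∉ Z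
    case-∪ (inj₁ p) = apart d p
    case-∪ (inj₂ p) = apart e p

  Meets-∪ˡ : Meets X Z → Meets (X ∪ Y) Z
  Meets-∪ˡ (c , p , q) = c , x∈p∪q⁺ (inj₁ p) , q

lookup-injective : ∀ {a} {X : Set a} {xs : List X} → Unique xs → ∀ i j → List.lookup xs i ≡ List.lookup xs j → i ≡ j
lookup-injective (_ ∷ _) zero zero _ = refl
lookup-injective (x∉ ∷ _) zero (suc j) e = ⊥-elim (All.lookup x∉ (∈-lookup j) e)
lookup-injective (x∉ ∷ _) (suc i) zero e = ⊥-elim (All.lookup x∉ (∈-lookup i) (sym e))
lookup-injective (_ ∷ u) (suc i) (suc j) e = cong suc (lookup-injective u i j e)

pick : ∀ {n} {xs : List (Fin n)} → Unique xs → ∀ ys → length ys < length xs → ∃ λ x → x ∈ˡ xs × x ∉ˡ ys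
pick {n} {xs} u ys lt with any? (λ i → ¬? (∈ˡ? (List.lookup xs i) ys))
... | yes (i , ∉ys) = List.lookup xs i , ∈-lookup i , ∉ys
... | no none = ⊥-elim (Fin.<⇒≢ i<j (lookup-injective u i j
    (trans (lookup-index (in-ys i)) (trans (cong (List.lookup ys) eq) (sym (lookup-index (in-ys j)))))))
  where
  in-ys : ∀ i → List.lookup xs i ∈ˡ ys
  in-ys i = decidable-stable (∈ˡ? (List.lookup xs i) ys) λ ∉ys → none (i , ∉ys)
  clash = pigeonhole lt (Any.index ∘ in-ys)
  i = proj₁ clash
  j = proj₁ (proj₂ clash)
  i<j = proj₁ (proj₂ (proj₂ clash))
  eq = proj₂ (proj₂ (proj₂ clash))

three : ∀ {a} {X : Set a} → X → X → X → Fin 3 → X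
three x y z zero = x
three x y z (suc zero) = y
three x y z (suc (suc zero)) = z

three-injective : ∀ {a} {X : Set a} {x y z : X} → x ≢ y → x ≢ z → y ≢ z →
  ∀ {i j} → three x y z i ≡ three x y z j → i ≡ j
three-injective p q r {zero} {zero} e = refl
three-injective p q r {zero} {suc zero} e = ⊥-elim (p e)
three-injective p q r {zero} {suc (suc zero)} e = ⊥-elim (q e)
three-injective p q r {suc zero} {zero} e = ⊥-elim (p (sym e))
three-injective p q r {suc zero} {suc zero} e = refl
three-injective p q r {suc zero} {suc (suc zero)} e = ⊥-elim (r e)
three-injective p q r {suc (suc zero)} {zero} e = ⊥-elim (q (sym e))
three-injective p q r {suc (suc zero)} {suc zero} e = ⊥-elim (r (sym e))
three-injective p q r {suc (suc zero)} {suc (suc zero)} e = refl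

pairwise-disj : (g : Fin 3 → Fin 3 → Mask) →
  Disj (g zero (suc zero)) (g (suc zero) zero) →
  Disj (g zero (suc (suc zero))) (g (suc (suc zero)) zero) →
  Disj (g (suc zero) (suc (suc zero))) (g (suc (suc zero)) (suc zero)) →
  ∀ {i j} → i ≢ j → Disj (g i j) (g j i)
pairwise-disj g d₀₁ d₀₂ d₁₂ {zero} {zero} ne = ⊥-elim (ne refl)
pairwise-disj g d₀₁ d₀₂ d₁₂ {zero} {suc zero} ne = d₀₁
pairwise-disj g d₀₁ d₀₂ d₁₂ {zero} {suc (suc zero)} ne = d₀₂
pairwise-disj g d₀₁ d₀₂ d₁₂ {suc zero} {zero} ne = Disj-sym d₀₁
pairwise-disj g d₀₁ d₀₂ d₁₂ {suc zero} {suc zero} ne = ⊥-elim (ne refl)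
pairwise-disj g d₀₁ d₀₂ d₁₂ {suc zero} {suc (suc zero)} ne = d₁₂
pairwise-disj g d₀₁ d₀₂ d₁₂ {suc (suc zero)} {zero} ne = Disj-sym d₀₂
pairwise-disj g d₀₁ d₀₂ d₁₂ {suc (suc zero)} {suc zero} ne = Disj-sym d₁₂
pairwise-disj g d₀₁ d₀₂ d₁₂ {suc (suc zero)} {suc (suc zero)} ne = ⊥-elim (ne refl)

pairwise-meets : (g : Fin 3 → Fin 3 → Mask) →
  Meets (g zero (suc zero)) (g zero (suc (suc zero))) →
  Meets (g (suc zero) zero) (g (suc zero) (suc (suc zero))) →
  Meets (g (suc (suc zero)) zero) (g (suc (suc zero)) (suc zero)) →
  ∀ {i j k} → i ≢ j → i ≢ k → j ≢ k → Meets (g i j) (g i k)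
pairwise-meets g m₀ m₁ m₂ {zero} {zero} p q r = ⊥-elim (p refl)
pairwise-meets g m₀ m₁ m₂ {zero} {suc _} {zero} p q r = ⊥-elim (q refl)
pairwise-meets g m₀ m₁ m₂ {zero} {suc zero} {suc zero} p q r = ⊥-elim (r refl)
pairwise-meets g m₀ m₁ m₂ {zero} {suc zero} {suc (suc zero)} p q r = m₀
pairwise-meets g m₀ m₁ m₂ {zero} {suc (suc zero)} {suc zero} p q r = Meets-sym m₀
pairwise-meets g m₀ m₁ m₂ {zero} {suc (suc zero)} {suc (suc zero)} p q r = ⊥-elim (r refl)
pairwise-meets g m₀ m₁ m₂ {suc zero} {zero} {zero} p q r = ⊥-elim (r refl)
pairwise-meets g m₀ m₁ m₂ {suc zero} {zero} {suc zero} p q r = ⊥-elim (q refl)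
pairwise-meets g m₀ m₁ m₂ {suc zero} {zero} {suc (suc zero)} p q r = m₁
pairwise-meets g m₀ m₁ m₂ {suc zero} {suc zero} p q r = ⊥-elim (p refl)
pairwise-meets g m₀ m₁ m₂ {suc zero} {suc (suc zero)} {zero} p q r = Meets-sym m₁
pairwise-meets g m₀ m₁ m₂ {suc zero} {suc (suc zero)} {suc zero} p q r = ⊥-elim (q refl)
pairwise-meets g m₀ m₁ m₂ {suc zero} {suc (suc zero)} {suc (suc zero)} p q r = ⊥-elim (r refl)
pairwise-meets g m₀ m₁ m₂ {suc (suc zero)} {zero} {zero} p q r = ⊥-elim (r refl)
pairwise-meets g m₀ m₁ m₂ {suc (suc zero)} {zero} {suc zero} p q r = m₂
pairwise-meets g m₀ m₁ m₂ {suc (suc zero)} {zero} {suc (suc zero)} p q r = ⊥-elim (q refl)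
pairwise-meets g m₀ m₁ m₂ {suc (suc zero)} {suc zero} {zero} p q r = Meets-sym m₂
pairwise-meets g m₀ m₁ m₂ {suc (suc zero)} {suc zero} {suc zero} p q r = ⊥-elim (r refl)
pairwise-meets g m₀ m₁ m₂ {suc (suc zero)} {suc zero} {suc (suc zero)} p q r = ⊥-elim (q refl)
pairwise-meets g m₀ m₁ m₂ {suc (suc zero)} {suc (suc zero)} p q r = ⊥-elim (p refl)

-- Configurations on more than twelve vertices

module _ {n : ℕ} (12<n : 12 < n) (C : Config n) where
  open Config C

  small : ∀ {k} → k ≤ 12 → k < n
  small k≤12 = ℕ.≤-<-trans k≤12 12<n

  Tr-rot : ∀ u v w → Tr u v w ≡ Tr v w u
  Tr-rot u v w = trans (Tr-swap u v w) (Tr-flip v u w)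

  Tr-A₂₁ : ∀ u v w → Disj (Tr u v w) (A v u)
  Tr-A₂₁ u v w = subst (λ X → Disj X (A v u)) (sym (Tr-swap u v w)) (Tr-A v u w)

  Tr-A₁₃ : ∀ u v w → Disj (Tr u v w) (A u w)
  Tr-A₁₃ u v w = subst (λ X → Disj X (A u w)) (sym (Tr-flip u v w)) (Tr-A u w v)

  Tr-A₃₁ : ∀ u v w → Disj (Tr u v w) (A w u)
  Tr-A₃₁ u v w = subst (λ X → Disj X (A w u)) (sym (Tr-flip u v w)) (Tr-A₂₁ u w v)

  Tr-A₂₃ : ∀ u v w → Disj (Tr u v w) (A v w)
  Tr-A₂₃ u v w = subst (λ X → Disj X (A v w)) (sym (Tr-rot u v w)) (Tr-A v w u)

  -- With `A u v` empty, every further vertex must form a triangle with `u` and `v`. Each of the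
  -- four colours allows one such triangle, so there would be at most six vertices.
  A-nonempty : ∀ u v → Nonempty (A u v)
  A-nonempty u v with u ≟ v
  ... | yes refl = zero , subst (zero ∈_) (sym (A-diag u)) ∈⊤
  ... | no u≢v with nonempty? (A u v)
  ...   | yes ne = ne
  ...   | no empty = ⊥-elim (ℕ.<⇒≱ (small (ℕ.m≤m+n 6 6)) (exhaustive⇒long xs all))
    where
    third : Fin 4 → Fin n
    third c with any? (λ w → c ∈? Tr u v w)
    ... | yes (w , _) = w
    -- A colour without a triangle on the edge gets `u`, which is in the list anyway.
    ... | no _ = u
    third-unique : ∀ {c w} → c ∈ Tr u v w → third c ≡ w
    third-unique {c} {w} m with any? (λ w → c ∈? Tr u v w)
    ... | no none = ⊥-elim (none (w , m))
    ... | yes (w' , m') with w' ≟ w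
    ...   | yes e = e
    ...   | no ne = ⊥-elim (apart (Tr-unique u v ne) m' m)
    xs : List (Fin n)
    xs = u ∷ v ∷ List.map third (allFin 4)
    all : ∀ z → z ∈ˡ xs
    all z with u ≟ z | v ≟ z
    ... | yes refl | _ = here refl
    ... | no _ | yes refl = there (here refl)
    ... | no u≢z | no v≢z with cover u≢v u≢z v≢z
    ...   | inj₁ (c , p , _) = ⊥-elim (empty (c , p))
    ...   | inj₂ (c , m) = there (there (subst (_∈ˡ List.map third (allFin 4)) (third-unique m) (∈-map⁺ third (∈-allFin c))))

  cover′ : ∀ u {v w} → v ≢ w → Meets (A u v) (A u w) ⊎ Nonempty (Tr u v w)
  cover′ u {v} {w} v≢w with u ≟ v | u ≟ w
  ... | no u≢v | no u≢w = cover u≢v u≢w v≢w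
  ... | yes refl | _ = inj₁ (let c , p = A-nonempty u w in c , subst (c ∈_) (sym (A-diag u)) ∈⊤ , p)
  ... | no _ | yes refl = inj₁ (let c , p = A-nonempty u v in c , p , subst (c ∈_) (sym (A-diag u)) ∈⊤)

  Disj⇒≢ : ∀ {u v w} → Disj (A u v) (A u w) → v ≢ w
  Disj⇒≢ {u} {v} d refl = let _ , p = A-nonempty u v in apart d p p

  Disj⇒Tr : ∀ {u v w} → Disj (A u v) (A u w) → Nonempty (Tr u v w)
  Disj⇒Tr {u} d with cover′ u (Disj⇒≢ d)
  ... | inj₁ m = ⊥-elim (Meets-¬Disj m d)
  ... | inj₂ ne = ne

  Tr-≢₁₃ : ∀ {u v w} → Nonempty (Tr u v w) → u ≢ w
  Tr-≢₁₃ {u} {v} {w} ne = Tr-≢ (subst Nonempty (Tr-flip u v w) ne)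

  Tr-≢₂₃ : ∀ {u v w} → Nonempty (Tr u v w) → v ≢ w
  Tr-≢₂₃ {u} {v} {w} ne = Tr-≢ (subst Nonempty (Tr-rot u v w) ne)

  -- `A u v`, `A v u` and the two triangle sets are nonempty and pairwise disjoint, so each has
  -- exactly one of the four colours.
  two-thirds⇒Single : ∀ {u v w w'} → w ≢ w' → Nonempty (Tr u v w) → Nonempty (Tr u v w') → Single (A u v)
  two-thirds⇒Single {u} {v} {w} {w'} ne t t' =
    four-disjoint _ (A-nonempty u v) _ (A-nonempty v u) (A-disj (Tr-≢ t))
      _ t (Disj-sym (Tr-A u v w)) (Disj-sym (Tr-A₂₁ u v w))
      _ t' (Disj-sym (Tr-A u v w')) (Disj-sym (Tr-A₂₁ u v w')) (Tr-unique u v ne)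

  -- A third triangle on the same edge would need a fifth colour.
  no-three-thirds : ∀ {u v w w' w''} → w ≢ w' → w ≢ w'' → w' ≢ w'' →
    Nonempty (Tr u v w) → Nonempty (Tr u v w') → ¬ Nonempty (Tr u v w'')
  no-three-thirds {u} {v} {w} {w'} {w''} ne ne' ne'' t t' t'' =
    five-disjoint _ (A-nonempty u v) _ (A-nonempty v u) (A-disj (Tr-≢ t))
      _ t (Disj-sym (Tr-A u v w)) (Disj-sym (Tr-A₂₁ u v w))
      _ t' (Disj-sym (Tr-A u v w')) (Disj-sym (Tr-A₂₁ u v w')) (Tr-unique u v ne)
      _ t'' (Disj-sym (Tr-A u v w'')) (Disj-sym (Tr-A₂₁ u v w'')) (Tr-unique u v ne') (Tr-unique u v ne'')

  -- Every further vertex z would have A z u equal to the one remaining colour, and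
  -- two such vertices would both claim that colour on the edge between them.
  no-three-disjoint : ∀ {u v₁ v₂ v₃} → Disj (A u v₁) (A u v₂) → Disj (A u v₁) (A u v₃) → ¬ Disj (A u v₂) (A u v₃)
  no-three-disjoint {u} {v₁} {v₂} {v₃} d₁₂ d₁₃ d₂₃ = conflict
    where
    far : ∀ {v w w' z} → Disj (A u v) (A u w) → Disj (A u v) (A u w') → w ≢ w' → z ≢ v → z ≢ w → z ≢ w' → Meets (A u v) (A u z)
    far {v} d d' w≢w' z≢v z≢w z≢w' with cover′ u (≢-sym z≢v)
    ... | inj₁ m = m
    ... | inj₂ ne = ⊥-elim (no-three-thirds w≢w' (≢-sym z≢w) (≢-sym z≢w') (Disj⇒Tr d) (Disj⇒Tr d') ne)
    v₁≢v₂ = Disj⇒≢ d₁₂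
    v₁≢v₃ = Disj⇒≢ d₁₃
    v₂≢v₃ = Disj⇒≢ d₂₃
    -- `A u z` contains all three single colours, so `A z u` is the fourth one and the edge has no
    -- colour left for a triangle.
    outer : ∀ z → z ∉ˡ (u ∷ v₁ ∷ v₂ ∷ v₃ ∷ []) →
      Single (A z u) × A z u ≡ ∁ (A u v₁ ∪ A u v₂ ∪ A u v₃) × (∀ W → Disj W (A u z) → Disj W (A z u) → ¬ Nonempty W)
    outer z z∉ = fourth-colour
      _ (two-thirds⇒Single v₂≢v₃ (Disj⇒Tr d₁₂) (Disj⇒Tr d₁₃))
      _ (two-thirds⇒Single v₁≢v₃ (Disj⇒Tr (Disj-sym d₁₂)) (Disj⇒Tr d₂₃)) d₁₂
      _ (two-thirds⇒Single v₁≢v₂ (Disj⇒Tr (Disj-sym d₁₃)) (Disj⇒Tr (Disj-sym d₂₃))) d₁₃ d₂₃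
      _ (far d₁₂ d₁₃ v₂≢v₃ z≢v₁ z≢v₂ z≢v₃)
        (far (Disj-sym d₁₂) d₂₃ v₁≢v₃ z≢v₂ z≢v₁ z≢v₃)
        (far (Disj-sym d₁₃) (Disj-sym d₂₃) v₁≢v₂ z≢v₃ z≢v₁ z≢v₂)
      _ (A-nonempty z u) (A-disj (λ e → z∉ (here (sym e))))
      where
      z≢v₁ = λ e → z∉ (there (here e))
      z≢v₂ = λ e → z∉ (there (there (here e)))
      z≢v₃ = λ e → z∉ (there (there (there (here e))))
    claims : ∀ {z z'} → z ∉ˡ (u ∷ v₁ ∷ v₂ ∷ v₃ ∷ []) → z' ≢ u → Meets (A z u) (A z z')
    claims {z} {z'} z∉ z'≢u with cover′ z (≢-sym z'≢u)
    ... | inj₁ m = m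
    ... | inj₂ ne = ⊥-elim (proj₂ (proj₂ (outer z z∉)) (Tr z u z') (Tr-A₂₁ z u z') (Tr-A z u z') ne)
    conflict : ⊥
    conflict with fresh (u ∷ v₁ ∷ v₂ ∷ v₃ ∷ []) (small (ℕ.m≤m+n 4 8))
    ... | z , z∉ with fresh (z ∷ u ∷ v₁ ∷ v₂ ∷ v₃ ∷ []) (small (ℕ.m≤m+n 5 7))
    ...   | z' , z'∉ =
      Meets-¬Disj (subst (λ X → Meets X (A z' z)) (trans (proj₁ (proj₂ (outer z' (z'∉ ∘ there)))) (sym (proj₁ (proj₂ (outer z z∉)))))
                    (claims (z'∉ ∘ there) (λ e → z∉ (here e))))
        (single-disj _ (proj₁ (outer z z∉)) _ (claims z∉ (λ e → z'∉ (there (here e)))) _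
          (A-disj (λ e → z'∉ (here (sym e)))))

  -- The triangle is needed at `u` at most. Its colours are added to `A u v` and `A u w`, which then
  -- meet in them; no other set changes.
  module Orient (u v w : Fin n) (tri : Nonempty (Tr u v w))
    (mv : Meets (A v u) (A v w)) (mw : Meets (A w u) (A w v)) where

    private
      t = three u v w
      τ = Tr u v w
      e : Fin 3 → Fin 3 → Mask
      e zero (suc _) = τ
      e _ _ = ∅
      g : Fin 3 → Fin 3 → Mask
      g i j = A (t i) (t j) ∪ e i j
      u≢v = Tr-≢ tri
      u≢w = Tr-≢₁₃ tri
      v≢w = Tr-≢₂₃ tri
      t-inj = three-injective u≢v u≢w v≢w
      open Replace C t (λ {i} {j} → t-inj {i} {j}) g
      ∪∅ : ∀ {X Y} → Disj {4} X Y → Disj (X ∪ ∅) Y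
      ∪∅ d = Disj-∪ d ∅-disj
      g-diag : ∀ i → g i i ≡ full
      g-diag zero rewrite A-diag u = refl
      g-diag (suc zero) rewrite A-diag v = refl
      g-diag (suc (suc zero)) rewrite A-diag w = refl
      g-disj = pairwise-disj g
        (Disj-∪ (Disj-sym (∪∅ (A-disj (≢-sym u≢v)))) (Disj-sym (∪∅ (Disj-sym (Tr-A₂₁ u v w)))))
        (Disj-∪ (Disj-sym (∪∅ (A-disj (≢-sym u≢w)))) (Disj-sym (∪∅ (Disj-sym (Tr-A₃₁ u v w)))))
        (∪∅ (Disj-sym (∪∅ (A-disj (≢-sym v≢w)))))
      g-Tr : ∀ {i j} → i ≢ j → ∀ {q} → Outside q → Disj (Tr (t i) (t j) q) (g i j)
      g-Tr {zero} {zero} ne _ = ⊥-elim (ne refl)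
      g-Tr {zero} {suc zero} ne o = Disj-sym (Disj-∪ (Disj-sym (Tr-A _ _ _)) (Tr-unique u v (o (suc (suc zero)))))
      g-Tr {zero} {suc (suc zero)} ne {q} o = Disj-sym (Disj-∪ (Disj-sym (Tr-A _ _ _))
        (subst (λ X → Disj X (Tr u w q)) (Tr-flip u w v) (Tr-unique u w (o (suc zero)))))
      g-Tr {suc i} {j} ne o = Disj-sym (∪∅ (Disj-sym (Tr-A _ _ _)))
      ∪ᵐ : ∀ {X Y X' Y'} → Meets {4} X Y → Meets (X ∪ X') (Y ∪ Y')
      ∪ᵐ m = Meets-∪ˡ (Meets-sym (Meets-∪ˡ (Meets-sym m)))
      g-meets = pairwise-meets g (let c , m = tri in c , x∈p∪q⁺ (inj₂ m) , x∈p∪q⁺ (inj₂ m)) (∪ᵐ mv) (∪ᵐ mw)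
      g-cover : ∀ {i j} → i ≢ j → ∀ {q} → Outside q → Meets (g i j) (A (t i) q) ⊎ Nonempty (Tr (t i) (t j) q)
      g-cover {i} {j} i≢j o with cover (i≢j ∘ t-inj) (o i) (o j)
      ... | inj₁ m = inj₁ (Meets-∪ˡ m)
      ... | inj₂ ne = inj₂ ne

    result : ∃ λ C′ → triangles C′ < triangles C
    result = config g-diag g-disj g-Tr g-meets g-cover ,
      fewer g-diag g-disj g-Tr g-meets g-cover zero (suc zero) (suc (suc zero)) tri

  -- The triangle u x y is not needed at u, so u keeps its sets and its colour τ moves to x
  -- and y on the edges to u; x then copies A x u to the edge xy, and y receives there
  -- everything that no other triangle uses.
  module Reroute {u v w x y : Fin n} (d-vw : Disj (A u v) (A u w)) (d-uy : Disj (A x u) (A x y))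
    (d-xu : Disj (A y x) (A y u)) (free : ∀ z → Meets (A u x) (A u z)) where

    private
      τ = Tr u x y
      p = A x u
      tri : Nonempty τ
      tri = subst Nonempty (Tr-swap x u y) (Disj⇒Tr d-uy)
      u≢x = Tr-≢ tri
      u≢y = Tr-≢₁₃ tri
      x≢y = Tr-≢₂₃ tri
      shape = tight (A u x) p (A-nonempty x u) (A-disj u≢x) τ tri (Tr-A u x y) (Tr-A₂₁ u x y)
        (A u v) (free v) (A u w) (free w) d-vw
      p-single = proj₁ shape
      τ-single = proj₁ (proj₂ shape)
      a≡ = proj₂ (proj₂ shape)

      -- `p`, `τ` and `A u x` exhaust the colours on the edge between `u` and `x`, so it lies in no
      -- triangle with `z`.
      p-meets : ∀ {z} → z ≢ u → z ≢ y → Meets p (A x z)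
      p-meets {z} z≢u z≢y with cover′ x (≢-sym z≢u)
      ... | inj₁ m = m
      ... | inj₂ ne = ⊥-elim (complement-exhausts p τ (Tr x u z) (Tr-A x u z)
        (subst (λ X → Disj X τ) (Tr-swap u x z) (Tr-unique u x z≢y))
        (subst (Disj (Tr x u z)) a≡ (Tr-A₂₁ x u z)) ne)

      used? : ∀ c → Dec (∃ λ q → q ≢ u × c ∈ Tr x y q)
      used? c = any? λ q → ¬? (q ≟ u) ×-dec c ∈? Tr x y q
      U R : Mask
      U = ⟦ used? ⟧
      R = ∁ (p ∪ U)
      Tr-yu : ∀ {q} → q ≢ x → Disj (Tr y u q) τ
      Tr-yu {q} q≢x = subst (Disj (Tr y u q)) (Tr-rot y u x) (Tr-unique y u q≢x)
      ab : Meets (∁ (p ∪ τ)) (A u y)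
      ab = subst (λ X → Meets X (A u y)) a≡ (free y)

      -- If `R` missed `A y z`, the old sets would meet only in `p`, so `p` would lie in both
      -- `A y x` and `A y z`. Then `p`, `τ`, `A y u` and `A u y` cover all colours, and each way of
      -- covering the pair `u`, `z` at `y` fails.
      exits : ∀ {z} → z ≢ u → z ≢ x → Meets R (A y z) ⊎ Nonempty (Tr y x z)
      exits {z} z≢u z≢x with cover′ y (≢-sym z≢x)
      ... | inj₂ ne = inj₂ ne
      ... | inj₁ mt with Meets-or-Disj R (A y z)
      ...   | inj₁ m = inj₁ m
      ...   | inj₂ dR = ⊥-elim impossible
        where
        t-U : Disj (A y x) U
        t-U = disj λ m m' → let q , _ , m'' = ∈⟦⟧⁻ used? m' in apart (Tr-A₂₁ x y q) m'' m
        pt = escape p p-single U (A y x) t-U (A y z) mt dR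
        p-m : Disj p (A y u)
        p-m = single-disj p p-single (A y x) (proj₁ pt) (A y u) d-xu
        forced : ∀ κ → Nonempty κ → Disj κ τ → Disj κ (A y u) → Disj κ (A u y) → κ ≡ p
        forced = last-colour p p-single τ τ-single (Tr-A₂₁ u x y) (A y u) (A-nonempty y u) p-m (Tr-A₃₁ u x y)
          (A u y) (A-disj u≢y) (Tr-A₁₃ u x y) ab
        impossible : ⊥
        impossible with cover′ y (≢-sym z≢u)
        -- A triangle `y u z` could only have colour `p`, which lies in `A y z`.
        ... | inj₂ ω = Meets-¬Disj (proj₂ pt) (subst (λ X → Disj X (A y z))
          (forced (Tr y u z) ω (Tr-yu z≢x) (Tr-A y u z) (Tr-A₂₁ y u z)) (Tr-A₁₃ y u z))
        ... | inj₁ mm with escape-other p p-single (A y u) p-m (A y z) mm U dR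
        ...   | c , c∈U , c∈m with ∈⟦⟧⁻ used? c∈U
        ...     | q , q≢u , c∈Tr with Meets-or-Disj (A y q) (A y u)
        -- `A y u` has only one colour, yet the disjoint `Tr x y q` and `A y q` both meet it.
        ...       | inj₁ mQ = crowded p p-single τ τ-single (Tr-A₂₁ u x y) (A y u) p-m (Tr-A₃₁ u x y)
          (A u y) (A-disj u≢y) ab (Tr x y q) (c , c∈Tr , c∈m) (A y q) (Tr-A₂₃ x y q) mQ
        -- `Tr y q u` and `A y x` are both equal to `p`, so `A y x` is disjoint from `A y q` as well
        -- as from `A y u`.
        ...       | inj₂ dQ = no-three-disjoint d-xu t-Q (Disj-sym dQ)
          where
          q≢x = ≢-sym (Tr-≢₁₃ (c , c∈Tr))
          κ≡p : Tr y q u ≡ p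
          κ≡p = forced (Tr y q u) (Disj⇒Tr dQ) (subst (λ X → Disj X τ) (Tr-flip y u q) (Tr-yu q≢x))
            (Tr-A₁₃ y q u) (Tr-A₃₁ y q u)
          t-single : Single (A y x)
          t-single = two-thirds⇒Single (≢-sym q≢u) (Disj⇒Tr d-xu) (c , subst (c ∈_) (Tr-swap x y q) c∈Tr)
          t-Q : Disj (A y x) (A y q)
          t-Q = subst (λ X → Disj X (A y q)) (trans κ≡p (single-unique p p-single (A y x) t-single (proj₁ pt)))
            (Tr-A y q u)

      t = three u x y
      g : Fin 3 → Fin 3 → Mask
      g zero (suc zero) = A u x
      g zero (suc (suc zero)) = A u y
      g (suc zero) zero = p ∪ τ
      g (suc zero) (suc (suc zero)) = p
      g (suc (suc zero)) zero = A y u ∪ τ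
      g (suc (suc zero)) (suc zero) = R
      g zero zero = full
      g (suc zero) (suc zero) = full
      g (suc (suc zero)) (suc (suc zero)) = full
      t-inj = three-injective u≢x u≢y x≢y
      open Replace C t (λ {i} {j} → t-inj {i} {j}) g
      g-diag : ∀ i → g i i ≡ full
      g-diag zero = refl
      g-diag (suc zero) = refl
      g-diag (suc (suc zero)) = refl
      g-disj = pairwise-disj g
        (Disj-sym (Disj-∪ (A-disj (≢-sym u≢x)) (Tr-A u x y)))
        (Disj-sym (Disj-∪ (A-disj (≢-sym u≢y)) (Tr-A₁₃ u x y)))
        (disj λ m m' → x∈∁p⇒x∉p m' (x∈p∪q⁺ (inj₁ m)))
      g-Tr : ∀ {i j} → i ≢ j → ∀ {q} → Outside q → Disj (Tr (t i) (t j) q) (g i j)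
      g-Tr {zero} {zero} ne o = ⊥-elim (ne refl)
      g-Tr {zero} {suc zero} ne o = Tr-A _ _ _
      g-Tr {zero} {suc (suc zero)} ne o = Tr-A _ _ _
      g-Tr {suc zero} {zero} ne {q} o = Disj-sym (Disj-∪ (Disj-sym (Tr-A x u q))
        (subst (Disj τ) (Tr-swap u x q) (Tr-unique u x (o (suc (suc zero))))))
      g-Tr {suc zero} {suc zero} ne o = ⊥-elim (ne refl)
      g-Tr {suc zero} {suc (suc zero)} ne {q} o = Disj-sym (single-disj p p-single (A x q)
        (p-meets (≢-sym (o zero)) (≢-sym (o (suc (suc zero))))) (Tr x y q) (Disj-sym (Tr-A₁₃ x y q)))
      g-Tr {suc (suc zero)} {zero} ne {q} o = Disj-sym (Disj-∪ (Disj-sym (Tr-A y u q)) (Disj-sym (Tr-yu (≢-sym (o (suc zero))))))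
      g-Tr {suc (suc zero)} {suc zero} ne {q} o = disj λ m m' → x∈∁p⇒x∉p m'
        (x∈p∪q⁺ (inj₂ (∈⟦⟧⁺ used? (q , ≢-sym (o zero) , subst (_ ∈_) (Tr-swap y x q) m))))
      g-Tr {suc (suc zero)} {suc (suc zero)} ne o = ⊥-elim (ne refl)
      τ⊆R : ∀ {c} → c ∈ τ → c ∈ R
      τ⊆R {c} m = x∉p⇒x∈∁p λ m' → excluded (x∈p∪q⁻ p U m')
        where
        excluded : ¬ (c ∈ p ⊎ c ∈ U)
        excluded (inj₁ m') = apart (Tr-A₂₁ u x y) m m'
        excluded (inj₂ m') = let q , q≢u , m'' = ∈⟦⟧⁻ used? m' in
          apart (Tr-unique x y q≢u) m'' (subst (c ∈_) (Tr-rot u x y) m)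
      g-meets = pairwise-meets g (free y)
        (let c , m = A-nonempty x u in c , x∈p∪q⁺ (inj₁ m) , m)
        (let c , m = tri in c , x∈p∪q⁺ (inj₂ m) , τ⊆R m)
      g-cover : ∀ {i j} → i ≢ j → ∀ {q} → Outside q → Meets (g i j) (A (t i) q) ⊎ Nonempty (Tr (t i) (t j) q)
      g-cover {zero} {zero} ne o = ⊥-elim (ne refl)
      g-cover {zero} {suc zero} ne o = cover′ u (o (suc zero))
      g-cover {zero} {suc (suc zero)} ne o = cover′ u (o (suc (suc zero)))
      g-cover {suc zero} {zero} ne o with cover′ x (o zero)
      ... | inj₁ m = inj₁ (Meets-∪ˡ m)
      ... | inj₂ ne' = inj₂ ne'
      g-cover {suc zero} {suc zero} ne o = ⊥-elim (ne refl)
      g-cover {suc zero} {suc (suc zero)} ne o = inj₁ (p-meets (≢-sym (o zero)) (≢-sym (o (suc (suc zero)))))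
      g-cover {suc (suc zero)} {zero} ne o with cover′ y (o zero)
      ... | inj₁ m = inj₁ (Meets-∪ˡ m)
      ... | inj₂ ne' = inj₂ ne'
      g-cover {suc (suc zero)} {suc zero} ne o = exits (≢-sym (o zero)) (≢-sym (o (suc zero)))
      g-cover {suc (suc zero)} {suc (suc zero)} ne o = ⊥-elim (ne refl)

    result : ∃ λ C′ → triangles C′ < triangles C
    result = config g-diag g-disj g-Tr g-meets g-cover ,
      fewer g-diag g-disj g-Tr g-meets g-cover zero (suc zero) (suc (suc zero)) tri

  -- For fixed u this is a graph of maximum degree two on the other vertices, without two
  -- independent edges far apart: it has at most four non-isolated vertices (InV u).
  Nb : Fin n → Fin n → Fin n → Set
  Nb u v w = Disj (A u v) (A u w)

  InV : Fin n → Fin n → Set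
  InV u v = ∃ λ w → Nb u v w

  InV? : ∀ u v → Dec (InV u v)
  InV? u v = any? λ w → Disj? (A u v) (A u w)

  ¬InV⇒Meets : ∀ {u v} → ¬ InV u v → ∀ w → Meets (A u v) (A u w)
  ¬InV⇒Meets {u} {v} ¬i w with Meets-or-Disj (A u v) (A u w)
  ... | inj₁ m = m
  ... | inj₂ d = ⊥-elim (¬i (w , d))

  Problem : Fin n → Set
  Problem u = ∃ λ v → InV u v

  Problem? : ∀ u → Dec (Problem u)
  Problem? u = any? (InV? u)

  -- A list-colouring certificate: every family forced by meeting the sets of the
  -- representatives is compatible with all vertices outside nbs.
  record Core (u : Fin n) : Set where
    constructor core
    field
      nbs reps : List (Fin n)
      nbs-complete : ∀ {h} → InV u h → h ∈ˡ nbs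
      enough : length nbs < length (candidates (List.map (A u) reps))

  -- Shapes of the conflict graph at a vertex

  module _ {u : Fin n} where

    Other : Fin n → Fin n → Set
    Other v w = ∃ λ w' → w' ≢ w × Nb u v w'

    Other? : ∀ v w → Dec (Other v w)
    Other? v w = any? λ w' → ¬? (w' ≟ w) ×-dec Disj? (A u v) (A u w')

    only : ∀ {v w a} → ¬ Other v w → Nb u v a → a ≡ w
    only {v} {w} {a} ¬o d with a ≟ w
    ... | yes e = e
    ... | no ne = ⊥-elim (¬o (a , ne , d))

    only-two : ∀ {v w w' a} → w' ≢ w → Nb u v w → Nb u v w' → Nb u v a → a ≡ w ⊎ a ≡ w'
    only-two {v} {w} {w'} {a} ne d d' e with a ≟ w | a ≟ w'
    ... | yes p | _ = inj₁ p
    ... | no _ | yes p = inj₂ p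
    ... | no p | no q = ⊥-elim (no-three-thirds (≢-sym ne) (≢-sym p) (≢-sym q) (Disj⇒Tr d) (Disj⇒Tr d') (Disj⇒Tr e))

    two⇒Single : ∀ {v w w'} → w' ≢ w → Nb u v w → Nb u v w' → Single (A u v)
    two⇒Single ne d d' = two-thirds⇒Single (≢-sym ne) (Disj⇒Tr d) (Disj⇒Tr d')

    -- The single colour of `A u v` cannot lie in two disjoint sets.
    side : ∀ {v a b} → Single (A u v) → Nb u a b → Nb u v a ⊎ Nb u v b
    side {v} {a} {b} s d with Meets-or-Disj (A u v) (A u a)
    ... | inj₂ e = inj₁ e
    ... | inj₁ m = inj₂ (single-disj _ s _ m _ d)

    -- Both inner sets are single colours, so by `side` every edge has an endpoint adjacent to `v`
    -- and one adjacent to `w`. Since degrees are at most two, only the four listed vertices remain.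
    core-path : ∀ {v w w' v'} → Nb u v w → w' ≢ w → Nb u v w' → v' ≢ v → Nb u w v' → Core u
    core-path {v} {w} {w'} {v'} vw w'≢w vw' v'≢v wv' =
      core (v ∷ w ∷ w' ∷ v' ∷ []) (v ∷ w ∷ []) complete (candidates₄ _ v-single _ w-single vw)
      where
      v-single = two⇒Single w'≢w vw vw'
      w-single = two⇒Single v'≢v (Disj-sym vw) wv'
      hs = v ∷ w ∷ w' ∷ v' ∷ []
      nb-v : ∀ {a} → Nb u v a → a ∈ˡ hs
      nb-v d with only-two w'≢w vw vw' d
      ... | inj₁ e = there (here e)
      ... | inj₂ e = there (there (here e))
      nb-w : ∀ {a} → Nb u w a → a ∈ˡ hs
      nb-w d with only-two v'≢v (Disj-sym vw) wv' d
      ... | inj₁ e = here e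
      ... | inj₂ e = there (there (there (here e)))
      complete : ∀ {a} → InV u a → a ∈ˡ hs
      complete {a} (b , ab) with side v-single ab | side w-single ab
      ... | inj₁ va | _ = nb-v va
      ... | inj₂ _ | inj₁ wa = nb-w wa
      ... | inj₂ vb | inj₂ wb with only-two (Disj⇒≢ (Disj-sym vw)) (Disj-sym vb) (Disj-sym wb) (Disj-sym ab)
      ...   | inj₁ e = here e
      ...   | inj₂ e = there (here e)

    core-cherry : ∀ {v w w'} → Nb u v w → w' ≢ w → Nb u v w' → ¬ Other w v → ¬ Other w' v → Core u
    core-cherry {v} {w} {w'} vw w'≢w vw' ¬ow ¬ow' =
      core (v ∷ w ∷ w' ∷ []) (v ∷ w ∷ w' ∷ []) complete
        (candidates₃ _ v-single
          _ (Disj⇒Tr vw) (Tr-A u v w) _ (Disj⇒Tr vw') (Tr-A u v w') (Tr-unique u v (≢-sym w'≢w))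
          _ vw (Tr-A₁₃ u v w) _ vw' (Tr-A₁₃ u v w') ww')
      where
      v-single = two⇒Single w'≢w vw vw'
      -- `w` has no neighbour but `v`, so the two leaves do not conflict.
      ww' : Meets (A u w) (A u w')
      ww' with Meets-or-Disj (A u w) (A u w')
      ... | inj₁ m = m
      ... | inj₂ d = ⊥-elim (¬ow (w' , ≢-sym (Disj⇒≢ vw') , d))
      complete : ∀ {a} → InV u a → a ∈ˡ (v ∷ w ∷ w' ∷ [])
      complete (b , ab) with side v-single ab
      ... | inj₁ va with only-two w'≢w vw vw' va
      ...   | inj₁ e = there (here e)
      ...   | inj₂ e = there (there (here e))
      complete (b , ab) | inj₂ vb with only-two w'≢w vw vw' vb
      ...   | inj₁ refl = here (only ¬ow (Disj-sym ab))
      ...   | inj₂ refl = here (only ¬ow' (Disj-sym ab))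

    -- `A u v`, `A u w` and `Tr u v w` are disjoint in four points, so one of the first two is a
    -- single colour and `side` excludes further edges.
    core-edge : ∀ {v w} → Nb u v w → ¬ Other v w → ¬ Other w v → Core u
    core-edge {v} {w} vw ¬ov ¬ow = core (v ∷ w ∷ []) (v ∷ w ∷ []) complete
      (candidates₂ _ (A-nonempty u v) _ (A-nonempty u w) vw _ (Disj⇒Tr vw) (Tr-A u v w) (Tr-A₁₃ u v w))
      where
      complete : ∀ {a} → InV u a → a ∈ˡ (v ∷ w ∷ [])
      complete (b , ab)
        with two-in-three _ (A-nonempty u v) _ (A-nonempty u w) vw _ (Disj⇒Tr vw) (Tr-A u v w) (Tr-A₁₃ u v w)
      ... | inj₁ s with side s ab
      ...   | inj₁ va = there (here (only ¬ov va))
      ...   | inj₂ vb with only ¬ov vb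
      ...     | refl = here (only ¬ow (Disj-sym ab))
      complete (b , ab) | inj₂ s with side s ab
      ...   | inj₁ wa = here (only ¬ow wa)
      ...   | inj₂ wb with only ¬ow wb
      ...     | refl = there (here (only ¬ov (Disj-sym ab)))

    core-fork : ∀ {v w w'} → Nb u v w → w' ≢ w → Nb u v w' → ¬ Other w v → Core u
    core-fork {v} {w} {w'} vw w'≢w vw' ¬ow with Other? w' v
    ... | yes (z , z≢v , d) = core-path vw' (≢-sym w'≢w) vw z≢v d
    ... | no ¬ow' = core-cherry vw w'≢w vw' ¬ow ¬ow'

  problem-core : ∀ {u} → Problem u → Core u
  problem-core {u} (v , w , vw) with Other? {u} v w | Other? {u} w v
  ... | yes (w' , p , vw') | yes (v' , q , wv') = core-path vw p vw' q wv'
  ... | yes (w' , p , vw') | no ¬ow = core-fork vw p vw' ¬ow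
  ... | no ¬ov | yes (v' , q , wv') = core-fork (Disj-sym vw) q wv' ¬ov
  ... | no ¬ov | no ¬ow = core-edge vw ¬ov ¬ow

  -- Without conflicts the sets `A u x` are pairwise intersecting, and they extend to a maximal
  -- family: a dictator if one of them is a singleton, otherwise the family given by a choice of
  -- halves.
  extension : ∀ u → ¬ Problem u → ∃ λ f → ∀ x → Mem f (A u x)
  extension u ¬p with any? (λ x → Single? (A u x))
  ... | yes (x , s) = let f , h = dictator _ s in f , λ z → h _ (¬InV⇒Meets (λ i → ¬p (x , i)) z)
  ... | no ¬s = let f , h = nondictator β in f , λ z → h _ (λ s → ¬s (z , s)) (β-meets z)
    where
    -- The half marked `true` is chosen unless its complement occurs among the sets at `u`.
    absent? : ∀ i → Dec (¬ ∃ λ x → A u x ≡ halves i false)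
    absent? i = ¬? (any? λ x → A u x ≟ˢ halves i false)
    β = tabulate (does ∘ absent?)
    β-meets : ∀ z i → Meets (A u z) (halves i (lookup β i))
    β-meets z i rewrite lookup∘tabulate (does ∘ absent?) i with any? (λ x → A u x ≟ˢ halves i false)
    ... | yes (x , e) = subst (Meets (A u z)) e (¬InV⇒Meets (λ d → ¬p (z , d)) x)
    ... | no none with halves-complement i (A u z) (A-nonempty u z) (λ s → ¬s (z , s))
    ...   | inj₁ e = ⊥-elim (none (z , e))
    ...   | inj₂ m = m

  -- Vertices without conflicts take a family containing all their sets; then the problem vertices
  -- are treated one by one, each avoiding the families of its conflicting vertices. Only
  -- conflicting vertices need explicitly different families.
  module Greedy (symmetric : ∀ {u x} → Problem u → InV x u → InV u x) where

    private
      Done : List (Fin n) → Fin n → Set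
      Done us u = ¬ Problem u ⊎ u ∈ˡ us

      Good : List (Fin n) → (Fin n → Fin 12) → Set
      Good us F = (∀ {u} → Done us u → ∀ {x} → ¬ InV u x → Mem (F u) (A u x))
                × (∀ {u x} → Done us u → Done us x → InV u x → F u ≢ F x)

      start : ∃ (Good [])
      start = F , contains , λ { (inj₁ ¬p) _ i → ⊥-elim (¬p (_ , i)) }
        where
        F : Fin n → Fin 12
        F u with Problem? u
        -- A placeholder: nothing is claimed about a problem vertex before it is processed.
        ... | yes _ = zero
        ... | no ¬p = proj₁ (extension u ¬p)
        contains : ∀ {u} → Done [] u → ∀ {x} → ¬ InV u x → Mem (F u) (A u x)
        contains {u} (inj₁ ¬p) {x} _ with Problem? u
        ... | yes p = ⊥-elim (¬p p)
        ... | no ¬p' = proj₂ (extension u ¬p') x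

      step : ∀ {us} → ∃ (Good us) → ∀ u → ∃ (Good (u ∷ us))
      step {us} (F , good) u with Problem? u
      ... | no ¬p = F , (λ d → proj₁ good (old d)) , (λ d e → proj₂ good (old d) (old e))
        where
        old : ∀ {x} → Done (u ∷ us) x → Done us x
        old (inj₁ ¬p) = inj₁ ¬p
        old (inj₂ (here refl)) = inj₁ ¬p
        old (inj₂ (there i)) = inj₂ i
      ... | yes p = F′ , contains , distinct
        where
        open Core (problem-core p)
        choice = pick (filter⁺ (Forced? (List.map (A u) reps)) (allFin⁺ 12)) (List.map F nbs)
          (subst (_< length (candidates (List.map (A u) reps))) (sym (length-map F nbs)) enough)
        f = proj₁ choice
        f-forced : Forced (List.map (A u) reps) f
        f-forced = proj₂ (∈-filter⁻ (Forced? (List.map (A u) reps)) {xs = allFin 12} (proj₁ (proj₂ choice)))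
        f-new : ∀ {x} → InV u x → f ≢ F x
        f-new i e = proj₂ (proj₂ choice) (subst (_∈ˡ List.map F nbs) (sym e) (∈-map⁺ F (nbs-complete i)))
        F′ : Fin n → Fin 12
        F′ x with x ≟ u
        ... | yes _ = f
        ... | no _ = F x
        old : ∀ {x} → x ≢ u → Done (u ∷ us) x → Done us x
        old ne (inj₁ ¬p) = inj₁ ¬p
        old ne (inj₂ (here e)) = ⊥-elim (ne e)
        old ne (inj₂ (there i)) = inj₂ i
        contains : ∀ {z} → Done (u ∷ us) z → ∀ {x} → ¬ InV z x → Mem (F′ z) (A z x)
        contains {z} d {x} ¬i with z ≟ u
        ... | yes refl = f-forced _ (All.map⁺ (All.universal (¬InV⇒Meets ¬i) reps))
        ... | no ne = proj₁ good (old ne d) ¬i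
        distinct : ∀ {z x} → Done (u ∷ us) z → Done (u ∷ us) x → InV z x → F′ z ≢ F′ x
        distinct {z} {x} d e i with z ≟ u | x ≟ u
        ... | yes refl | yes refl = ⊥-elim (Tr-≢ (Disj⇒Tr (proj₂ i)) refl)
        ... | yes refl | no _ = f-new i
        -- The conflict is seen from `z`; `symmetric` puts `z` among the vertices that `f` avoids.
        ... | no _ | yes refl = ≢-sym (f-new (symmetric p i))
        ... | no ne | no ne' = proj₂ good (old ne d) (old ne' e) i

      colouring : ∀ us → ∃ (Good us)
      colouring [] = start
      colouring (u ∷ us) = step (colouring us) u

    -- Two of more than twelve vertices share a family. They do not conflict, so this intersecting
    -- family contains both `A u x` and `A x u`, which are disjoint.
    contradiction : ⊥
    contradiction with colouring (allFin n)
    ... | F , contains , distinct with pigeonhole 12<n F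
    ...   | u , x , u<x , e with InV? u x | InV? x u
    ...     | yes i | _ = distinct (inj₂ (∈-allFin u)) (inj₂ (∈-allFin x)) i e
    ...     | no _ | yes i = distinct (inj₂ (∈-allFin x)) (inj₂ (∈-allFin u)) i (sym e)
    ...     | no ¬i | no ¬i' = Meets-¬Disj
      (Mem-meets (F u) _ (contains (inj₂ (∈-allFin u)) ¬i) _
        (subst (λ f → Mem f (A x u)) (sym e) (contains (inj₂ (∈-allFin x)) ¬i')))
      (A-disj (Fin.<⇒≢ u<x))

  improve : ∃ λ C′ → triangles C′ < triangles C
  improve with any? (λ u → any? λ v → any? λ w →
                 nonempty? (Tr u v w) ×-dec Meets? (A v u) (A v w) ×-dec Meets? (A w u) (A w v))
  ... | yes (u , v , w , tri , mv , mw) = Orient.result u v w tri mv mw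
  ... | no ¬lonely with any? (λ u → any? λ x → Problem? u ×-dec InV? x u ×-dec ¬? (InV? u x))
  ...   | no ¬asym = ⊥-elim (Greedy.contradiction λ {u} {x} p i →
            decidable-stable (InV? u x) λ ¬i → ¬asym (u , x , p , i , ¬i))
  ...   | yes (u , x , (v , w , vw) , (y , uy) , ¬i) = Reroute.result vw uy xu (¬InV⇒Meets ¬i)
    where
    xu : Disj (A y x) (A y u)
    xu with Meets-or-Disj (A y x) (A y u)
    ... | inj₂ d = d
    ... | inj₁ m = ⊥-elim (¬lonely (x , u , y , Disj⇒Tr uy , ¬InV⇒Meets ¬i y , m))

no-config : ∀ {n} → 12 < n → ¬ Config n
no-config {n} 12<n C = descend {C} (<-wellFounded (triangles C))
  where
  descend : ∀ {C : Config n} → Acc _<_ (triangles C) → ⊥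
  descend {C} (acc rs) = let C′ , lt = improve 12<n C in descend {C′} (rs lt)

⟦⟧-cong : ∀ {n} {P Q : Fin n → Set} (P? : ∀ c → Dec (P c)) (Q? : ∀ c → Dec (Q c)) →
  (∀ {c} → P c → Q c) → (∀ {c} → Q c → P c) → ⟦ P? ⟧ ≡ ⟦ Q? ⟧
⟦⟧-cong P? Q? f g = ⊆-antisym (∈⟦⟧⁺ Q? ∘ f ∘ ∈⟦⟧⁻ P?) (∈⟦⟧⁺ P? ∘ g ∘ ∈⟦⟧⁻ Q?)

-- Complete graphs

edges : ℕ → ℕ
edges zero = 0
edges (suc n) = n + edges n

ends : ∀ n → Fin (edges n) → Fin n × Fin n
ends (suc n) e with splitAt n e
... | inj₁ i = zero , suc i
... | inj₂ e' = suc (proj₁ (ends n e')) , suc (proj₂ (ends n e'))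

ends-< : ∀ n e → proj₁ (ends n e) Fin.< proj₂ (ends n e)
ends-< (suc n) e with splitAt n e
... | inj₁ i = s≤s z≤n
... | inj₂ e' = s≤s (ends-< n e')

ends-injective : ∀ n e f → proj₁ (ends n e) ≡ proj₁ (ends n f) → proj₂ (ends n e) ≡ proj₂ (ends n f) → e ≡ f
ends-injective (suc n) e f p q with splitAt n e in eqe | splitAt n f in eqf
... | inj₁ i | inj₁ j =
  trans (sym (splitAt⁻¹-↑ˡ eqe)) (trans (cong (_↑ˡ edges n) (Fin.suc-injective q)) (splitAt⁻¹-↑ˡ eqf))
... | inj₁ i | inj₂ f' = ⊥-elim (Fin.0≢1+n p)
... | inj₂ e' | inj₁ j = ⊥-elim (Fin.0≢1+n (sym p))
... | inj₂ e' | inj₂ f' = trans (sym (splitAt⁻¹-↑ʳ eqe))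
  (trans (cong (n ↑ʳ_) (ends-injective n e' f' (Fin.suc-injective p) (Fin.suc-injective q))) (splitAt⁻¹-↑ʳ eqf))

ends-complete : ∀ n {u v} → u Fin.< v → ∃ λ e → proj₁ (ends n e) ≡ u × proj₂ (ends n e) ≡ v
ends-complete (suc n) {zero} {suc v} _ = v ↑ˡ edges n , lemma
  where
  lemma : proj₁ (ends (suc n) (v ↑ˡ edges n)) ≡ zero × proj₂ (ends (suc n) (v ↑ˡ edges n)) ≡ suc v
  lemma rewrite splitAt-↑ˡ n v (edges n) = refl , refl
ends-complete (suc n) {suc u} {suc v} (s≤s u<v) with ends-complete n u<v
... | e , p , q = n ↑ʳ e , lemma
  where
  lemma : proj₁ (ends (suc n) (n ↑ʳ e)) ≡ suc u × proj₂ (ends (suc n) (n ↑ʳ e)) ≡ suc v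
  lemma rewrite splitAt-↑ʳ n (edges n) e = cong suc p , cong suc q

Joins : (G : Graph) → Fin (ne G) → Fin (nv G) → Fin (nv G) → Set
Joins G e u v = (src G e ≡ u × tgt G e ≡ v) ⊎ (src G e ≡ v × tgt G e ≡ u)

Complete : Graph → Set
Complete G = ∀ {u v} → u ≢ v → ∃ λ e → Joins G e u v

K : ℕ → Graph
K n = record
  { nv = n ; ne = edges n ; src = proj₁ ∘ ends n ; tgt = proj₂ ∘ ends n
  ; loopless = λ e → Fin.<⇒≢ (ends-< n e)
  ; simple = λ e f → (λ { (p , q) → ends-injective n e f p q })
      , (λ { (p , q) → ⊥-elim (ℕ.<-asym (ends-< n e) (subst₂< (sym q) (sym p) (ends-< n f))) }) }
  where
  subst₂< : ∀ {a b c d : Fin n} → a ≡ c → b ≡ d → a Fin.< b → c Fin.< d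
  subst₂< refl refl lt = lt

K-complete : ∀ n → Complete (K n)
K-complete n {u} {v} u≢v with ℕ.<-cmp (Fin.toℕ u) (Fin.toℕ v)
... | tri< lt _ _ = let e , j = ends-complete n lt in e , inj₁ j
... | tri≈ _ eq _ = ⊥-elim (u≢v (Fin.toℕ-injective eq))
... | tri> _ _ gt = let e , j = ends-complete n gt in e , inj₂ j

-- Parallel elements of a matroid

pair : ∀ {m} → Fin m → Fin m → Subset m
pair e f = ⁅ e ⁆ ∪ ⁅ f ⁆

∈pair⁻ : ∀ {m} {e f x : Fin m} → x ∈ pair e f → x ≡ e ⊎ x ≡ f
∈pair⁻ {e = e} {f} i = Sum.map (x∈⁅y⁆⇒x≡y e) (x∈⁅y⁆⇒x≡y f) (x∈p∪q⁻ ⁅ e ⁆ ⁅ f ⁆ i)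

fst∈pair : ∀ {m} {e f : Fin m} → e ∈ pair e f
fst∈pair {e = e} = x∈p∪q⁺ (inj₁ (x∈⁅x⁆ e))

snd∈pair : ∀ {m} {e f : Fin m} → f ∈ pair e f
snd∈pair {f = f} = x∈p∪q⁺ (inj₂ (x∈⁅x⁆ f))

pair⊆ : ∀ {m} {e f : Fin m} {X} → e ∈ X → f ∈ X → pair e f ⊆ X
pair⊆ i j k with ∈pair⁻ k
... | inj₁ refl = i
... | inj₂ refl = j

Parallel : ∀ {m} → Family m → Fin m → Fin m → Set
Parallel F e f = ¬ (pair e f ∈F F)

-- Otherwise `pair e g` and `⁅ f ⁆` would both be maximal within the three elements, with different
-- sizes.
parallel-trans : ∀ {m} {F : Family m} → IsMatroid F → (∀ e → ⁅ e ⁆ ∈F F) →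
  ∀ {e f g} → e ≢ g → Parallel F e f → Parallel F f g → Parallel F e g
parallel-trans {F = F} (_ , down , equi) singles {e} {f} {g} e≢g ef fg eg =
  ℕ.<-irrefl (trans (∣⁅x⁆∣≡1 e) (sym (trans (equi S (pair e g) ⁅ f ⁆ max₁ max₂) (∣⁅x⁆∣≡1 f))))
    (p⊂q⇒∣p∣<∣q∣ (p⊆p∪q ⁅ g ⁆ , g , snd∈pair , λ i → e≢g (sym (x∈⁅y⁆⇒x≡y e i))))
  where
  S = pair e g ∪ ⁅ f ⁆
  ∈S⁻ : ∀ {z} → z ∈ S → z ∈ pair e g ⊎ z ≡ f
  ∈S⁻ i = Sum.map₂ (x∈⁅y⁆⇒x≡y f) (x∈p∪q⁻ (pair e g) ⁅ f ⁆ i)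
  max₁ : MaximalIn F S (pair e g)
  max₁ = p⊆p∪q ⁅ f ⁆ , eg , λ Z X⊆Z Z⊆S ZF → ⊆-antisym (λ {z} i → inside-pair Z X⊆Z ZF i (∈S⁻ (Z⊆S i))) X⊆Z
    where
    inside-pair : ∀ Z → pair e g ⊆ Z → Z ∈F F → ∀ {z} → z ∈ Z → z ∈ pair e g ⊎ z ≡ f → z ∈ pair e g
    inside-pair Z X⊆Z ZF i (inj₁ p) = p
    inside-pair Z X⊆Z ZF i (inj₂ refl) = ⊥-elim (ef (down Z _ ZF (pair⊆ (X⊆Z fst∈pair) i)))
  max₂ : MaximalIn F S ⁅ f ⁆
  max₂ = (λ i → x∈p∪q⁺ (inj₂ i)) , singles f , λ Z f⊆Z Z⊆S ZF →
    ⊆-antisym (λ {z} i → is-f Z (f⊆Z (x∈⁅x⁆ f)) ZF i (∈S⁻ (Z⊆S i))) f⊆Z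
    where
    is-f : ∀ Z → f ∈ Z → Z ∈F F → ∀ {z} → z ∈ Z → z ∈ pair e g ⊎ z ≡ f → z ∈ ⁅ f ⁆
    is-f Z f∈Z ZF i (inj₂ refl) = x∈⁅x⁆ f
    is-f Z f∈Z ZF i (inj₁ p) with ∈pair⁻ p
    ... | inj₁ refl = ⊥-elim (ef (down Z _ ZF (pair⊆ i f∈Z)))
    ... | inj₂ refl = ⊥-elim (fg (down Z _ ZF (pair⊆ f∈Z i)))

-- From four matroids to a configuration

module FromMatroids (G : Graph) (complete : Complete G) (I : IntersectionOf G 4) where

  private
    V = Fin (nv G)
    E = Fin (ne G)
    M : Fin 4 → Family (ne G)
    M = proj₁ I
    matroid = proj₁ (proj₂ I)

    matching⇒ : ∀ {X} → IsMatching G X → ∀ c → X ∈F M c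
    matching⇒ {X} = Equivalence.to (proj₂ (proj₂ I) X)

    singles : ∀ c e → ⁅ e ⁆ ∈F M c
    singles c e = matching⇒ (λ f g i j f≢g → ⊥-elim (f≢g (trans (x∈⁅y⁆⇒x≡y e i) (sym (x∈⁅y⁆⇒x≡y e j))))) c

    Par : Fin 4 → E → E → Set
    Par c = Parallel (M c)

    Par-sym : ∀ {c e f} → Par c e f → Par c f e
    Par-sym {c} {e} {f} p q = p (subst (_∈F M c) (∪-comm ⁅ f ⁆ ⁅ e ⁆) q)

    Par-≢ : ∀ {c e f} → Par c e f → e ≢ f
    Par-≢ {c} {e} p refl = p (subst (_∈F M c) (sym (∪-idem ⁅ e ⁆)) (singles c e))

    -- Two disjoint edges form a matching, which every matroid of the intersection contains.
    Par-meet : ∀ {c e f} → Par c e f → ¬ (∀ v → ¬ (Incident G v e × Incident G v f))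
    Par-meet {c} {e} {f} p apart′ = p (matching⇒ matching c)
      where
      matching : IsMatching G (pair e f)
      matching a b i j a≢b v (ia , ib) with ∈pair⁻ i | ∈pair⁻ j
      ... | inj₁ refl | inj₁ refl = a≢b refl
      ... | inj₁ refl | inj₂ refl = apart′ v (ia , ib)
      ... | inj₂ refl | inj₁ refl = apart′ v (ib , ia)
      ... | inj₂ refl | inj₂ refl = a≢b refl

    ∃Par : ∀ {e f} → e ≢ f → ∀ v → Incident G v e → Incident G v f → ∃ λ c → Par c e f
    ∃Par {e} {f} e≢f v ie jf = ¬∀⟶∃¬ 4 (λ c → pair e f ∈F M c) (λ c → M c (pair e f) Bool.≟ true)
      λ all → Equivalence.from (proj₂ (proj₂ I) (pair e f)) all e f fst∈pair snd∈pair e≢f v (ie , jf)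

    J : E → V → V → Set
    J = Joins G

    J? : ∀ e u v → Dec (J e u v)
    J? e u v = (src G e ≟ u ×-dec tgt G e ≟ v) ⊎-dec (src G e ≟ v ×-dec tgt G e ≟ u)

    J-sym : ∀ {e u v} → J e u v → J e v u
    J-sym = Sum.swap

    J-≢ : ∀ {e u v} → J e u v → u ≢ v
    J-≢ {e} (inj₁ (refl , q)) refl = loopless G e (sym q)
    J-≢ {e} (inj₂ (p , refl)) refl = loopless G e p

    J-unique : ∀ {e f u v} → J e u v → J f u v → e ≡ f
    J-unique {e} {f} (inj₁ (p , q)) (inj₁ (p' , q')) = proj₁ (simple G e f) (trans p (sym p') , trans q (sym q'))
    J-unique {e} {f} (inj₁ (p , q)) (inj₂ (p' , q')) = proj₂ (simple G e f) (trans p (sym q') , trans q (sym p'))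
    J-unique {e} {f} (inj₂ (p , q)) (inj₁ (p' , q')) = proj₂ (simple G e f) (trans p (sym q') , trans q (sym p'))
    J-unique {e} {f} (inj₂ (p , q)) (inj₂ (p' , q')) = proj₁ (simple G e f) (trans p (sym p') , trans q (sym q'))

    J-incident : ∀ {e u v} → J e u v → Incident G u e
    J-incident (inj₁ (p , _)) = inj₁ (sym p)
    J-incident (inj₂ (_ , q)) = inj₂ (sym q)

    J-ends : ∀ {e u v x} → J e u v → Incident G x e → x ≡ u ⊎ x ≡ v
    J-ends (inj₁ (p , q)) (inj₁ i) = inj₁ (trans i p)
    J-ends (inj₁ (p , q)) (inj₂ i) = inj₂ (trans i q)
    J-ends (inj₂ (p , q)) (inj₁ i) = inj₂ (trans i p)
    J-ends (inj₂ (p , q)) (inj₂ i) = inj₁ (trans i q)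

    J-other : ∀ {e u v w} → J e u v → J e u w → v ≡ w
    J-other {v = v} j k with J-ends k (J-incident (J-sym j))
    ... | inj₁ refl = ⊥-elim (J-≢ j refl)
    ... | inj₂ eq = eq

    -- Parallelism of two edges at `u`, expressed by vertices. With the edges quantified, it is
    -- simply false where an edge does not exist.
    D : Fin 4 → V → V → V → Set
    D c u v w = ∃₂ λ e f → J e u v × J f u w × Par c e f

    D? : ∀ c u v w → Dec (D c u v w)
    D? c u v w = any? λ e → any? λ f → J? e u v ×-dec J? f u w ×-dec ¬? (M c (pair e f) Bool.≟ true)

    D-sym : ∀ {c u v w} → D c u v w → D c u w v
    D-sym (e , f , j , k , p) = f , e , k , j , Par-sym p

    D-≢ : ∀ {c u v w} → D c u v w → u ≢ v
    D-≢ (_ , _ , j , _) = J-≢ j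

    D-≢′ : ∀ {c u v w} → D c u v w → v ≢ w
    D-≢′ (_ , _ , j , k , p) refl = Par-≢ p (J-unique j k)

    -- By transitivity through the edge `u v`, the edges `u w` and `v w'` would be parallel although
    -- disjoint. This is why parallel classes are stars or triangles.
    D-clash : ∀ {c u v w w'} → D c u v w → D c v u w' → ¬ w ≢ w'
    D-clash {c} {u} {v} {w} {w'} d@(e , f , j , k , p) d'@(e' , f' , j' , k' , p') w≢w'
      with J-unique j (J-sym j')
    ... | refl = Par-meet f∥f' disjoint-ends
      where
      disjoint-ends : ∀ x → ¬ (Incident G x f × Incident G x f')
      disjoint-ends x (i , i') with J-ends k i | J-ends k' i'
      ... | inj₁ refl | inj₁ r = J-≢ j r
      ... | inj₁ refl | inj₂ r = D-≢′ d' r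
      ... | inj₂ refl | inj₁ r = D-≢′ d (sym r)
      ... | inj₂ refl | inj₂ r = w≢w' r
      f≢f' : f ≢ f'
      f≢f' refl = disjoint-ends u (J-incident k , subst (Incident G u) refl (J-incident k))
      f∥f' : Par c f f'
      f∥f' = parallel-trans (matroid c) (singles c) f≢f' (Par-sym p) p'

    D-third : ∀ {c u v w} → D c u v w → D c v u w → D c w u v
    D-third {c} {u} {v} {w} (e , f , j , k , p) (e' , f' , j' , k' , p') with J-unique j (J-sym j')
    ... | refl = f , f' , J-sym k , J-sym k' , parallel-trans (matroid c) (singles c) f≢f' (Par-sym p) p'
      where
      f≢f' : f ≢ f'
      f≢f' refl = J-≢ j (J-other (J-sym k) (J-sym k'))

    Triangle : V → V → V → Fin 4 → Set
    Triangle u v w c = D c u v w × D c v u w × D c w u v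

    Triangle? : ∀ u v w c → Dec (Triangle u v w c)
    Triangle? u v w c = D? c u v w ×-dec D? c v u w ×-dec D? c w u v

    -- The witness `w` fixes the centre: a class consisting of one edge is a star at neither end.
    -- The first summand supplies the full set on the diagonal.
    Star : V → V → Fin 4 → Set
    Star u v c = u ≡ v ⊎ ∃ λ w → D c u v w × ¬ D c v u w

    Star? : ∀ u v c → Dec (Star u v c)
    Star? u v c = u ≟ v ⊎-dec any? λ w → D? c u v w ×-dec ¬? (D? c v u w)

    Star-disj : ∀ {u v c} → u ≢ v → Star u v c → ¬ Star v u c
    Star-disj u≢v (inj₁ e) _ = u≢v e
    Star-disj u≢v (inj₂ _) (inj₁ e) = u≢v (sym e)
    Star-disj u≢v (inj₂ (w , d , ¬d)) (inj₂ (w' , d' , ¬d')) = D-clash d d' λ { refl → ¬d d' }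

    Triangle-Star : ∀ {u v w c} → Triangle u v w c → ¬ Star u v c
    Triangle-Star (d , _) (inj₁ e) = D-≢ d e
    Triangle-Star (_ , d , _) (inj₂ (w' , d' , ¬d')) = D-clash d' d λ { refl → ¬d' d }

    swapped : ∀ {u v w c} → Triangle u v w c → Triangle v u w c
    swapped (d₁ , d₂ , d₃) = d₂ , d₁ , D-sym d₃

    flipped : ∀ {u v w c} → Triangle u v w c → Triangle u w v c
    flipped (d₁ , d₂ , d₃) = D-sym d₁ , d₃ , d₂

    covered : ∀ {u v w} → u ≢ v → u ≢ w → v ≢ w →
      Meets ⟦ Star? u v ⟧ ⟦ Star? u w ⟧ ⊎ Nonempty ⟦ Triangle? u v w ⟧
    covered {u} {v} {w} u≢v u≢w v≢w with complete u≢v | complete u≢w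
    ... | e , j | f , k with ∃Par {e} {f} (λ { refl → v≢w (J-other j k) }) u (J-incident j) (J-incident k)
    ...   | c , p with D? c v u w
    ...     | yes d = inj₂ (c , ∈⟦⟧⁺ (Triangle? u v w) ((e , f , j , k , p) , d , D-third (e , f , j , k , p) d))
    ...     | no ¬d = inj₁ (c , ∈⟦⟧⁺ (Star? u v) (inj₂ (w , duvw , ¬d))
                              , ∈⟦⟧⁺ (Star? u w) (inj₂ (v , D-sym duvw , λ d → ¬d (D-third (D-sym duvw) d))))
      where
      duvw : D c u v w
      duvw = e , f , j , k , p

  config : Config (nv G)
  config = record
    { A = λ u v → ⟦ Star? u v ⟧
    ; Tr = λ u v w → ⟦ Triangle? u v w ⟧
    ; A-diag = λ u → ⊆-antisym ⊆⊤ (λ _ → ∈⟦⟧⁺ (Star? u u) (inj₁ refl))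
    ; A-disj = λ {u} {v} u≢v → disj λ m m' → Star-disj u≢v (∈⟦⟧⁻ (Star? u v) m) (∈⟦⟧⁻ (Star? v u) m')
    ; Tr-swap = λ u v w → ⟦⟧-cong (Triangle? u v w) (Triangle? v u w) swapped swapped
    ; Tr-flip = λ u v w → ⟦⟧-cong (Triangle? u v w) (Triangle? u w v) flipped flipped
    ; Tr-≢ = λ {u} {v} {w} (c , m) → D-≢ (proj₁ (∈⟦⟧⁻ (Triangle? u v w) m))
    ; Tr-A = λ u v w → disj λ m m' → Triangle-Star (∈⟦⟧⁻ (Triangle? u v w) m) (∈⟦⟧⁻ (Star? u v) m')
    ; Tr-unique = λ u v {w} {w'} w≢w' → disj λ m m' →
        D-clash (proj₁ (∈⟦⟧⁻ (Triangle? u v w) m)) (proj₁ (proj₂ (∈⟦⟧⁻ (Triangle? u v w') m'))) w≢w'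
    ; cover = covered }

-- Padding an intersection, and the lower bound

free-matroid : ∀ {m} → IsMatroid {m} (λ _ → true)
free-matroid = refl , (λ _ _ _ _ → refl) , λ S X Y mx my → cong ∣_∣ (trans (sym (whole mx)) (whole my))
  where
  whole : ∀ {S X} → MaximalIn (λ _ → true) S X → S ≡ X
  whole {S} (X⊆S , _ , max) = max S X⊆S (λ i → i) refl

-- The free matroid imposes nothing; padding with it reduces fewer than four matroids to exactly
-- four.
one-more : ∀ G {k} → IntersectionOf G k → IntersectionOf G (suc k)
one-more G {k} (M , matroid , inter) = M′ , matroid′ , λ X → mk⇔
  (λ { mt zero → refl ; mt (suc i) → Equivalence.to (inter X) mt i })
  (λ all → Equivalence.from (inter X) (all ∘ suc))
  where
  M′ : Fin (suc k) → Family (ne G)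
  M′ zero = λ _ → true
  M′ (suc i) = M i
  matroid′ : ∀ i → IsMatroid (M′ i)
  matroid′ zero = free-matroid
  matroid′ (suc i) = matroid i

more : ∀ G {j k} → j ℕ.≤′ k → IntersectionOf G j → IntersectionOf G k
more G ℕ.≤′-refl I = I
more G (ℕ.≤′-step le) I = one-more G (more G le I)

K-lower : ∀ {n j} → 12 < n → j ≤ 4 → ¬ IntersectionOf (K n) j
K-lower {n} 12<n j≤4 I =
  no-config 12<n (FromMatroids.config (K n) (λ {u} {v} → K-complete n {u} {v}) (more (K n) (ℕ.≤⇒≤′ j≤4) I))

-- Partition matroids

∣⁅x⁆∪p∣ : ∀ {n} {x : Fin n} {p} → x ∉ p → ∣ ⁅ x ⁆ ∪ p ∣ ≡ suc ∣ p ∣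
∣⁅x⁆∪p∣ {x = zero} {inside ∷ p} x∉p = ⊥-elim (x∉p here)
∣⁅x⁆∪p∣ {x = zero} {outside ∷ p} x∉p = cong (suc ∘ ∣_∣) (∪-identityˡ p)
∣⁅x⁆∪p∣ {x = suc x} {inside ∷ p} x∉p = cong suc (∣⁅x⁆∪p∣ (x∉p ∘ there))
∣⁅x⁆∪p∣ {x = suc x} {outside ∷ p} x∉p = ∣⁅x⁆∪p∣ (x∉p ∘ there)

image : ∀ {m p} → (Fin m → Fin p) → Subset m → Subset p
image k [] = ∅
image k (inside ∷ X) = ⁅ k zero ⁆ ∪ image (k ∘ suc) X
image k (outside ∷ X) = image (k ∘ suc) X

∈image⁺ : ∀ {m p} (k : Fin m → Fin p) {e X} → e ∈ X → k e ∈ image k X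
∈image⁺ k {X = inside ∷ X} here = x∈p∪q⁺ (inj₁ (x∈⁅x⁆ (k zero)))
∈image⁺ k {X = inside ∷ X} (there i) = x∈p∪q⁺ (inj₂ (∈image⁺ (k ∘ suc) i))
∈image⁺ k {X = outside ∷ X} (there i) = ∈image⁺ (k ∘ suc) i

∈image⁻ : ∀ {m p} (k : Fin m → Fin p) X {v} → v ∈ image k X → ∃ λ e → e ∈ X × k e ≡ v
∈image⁻ k [] i = ⊥-elim (∉⊥ i)
∈image⁻ k (inside ∷ X) i with x∈p∪q⁻ ⁅ k zero ⁆ (image (k ∘ suc) X) i
... | inj₁ j = zero , here , sym (x∈⁅y⁆⇒x≡y (k zero) j)
... | inj₂ j = let e , e∈X , eq = ∈image⁻ (k ∘ suc) X j in suc e , there e∈X , eq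
∈image⁻ k (outside ∷ X) i = let e , e∈X , eq = ∈image⁻ (k ∘ suc) X i in suc e , there e∈X , eq

InjectiveOn : ∀ {m p} → (Fin m → Fin p) → Subset m → Set
InjectiveOn k X = ∀ e f → e ∈ X → f ∈ X → k e ≡ k f → e ≡ f

InjectiveOn? : ∀ {m p} (k : Fin m → Fin p) X → Dec (InjectiveOn k X)
InjectiveOn? k X = all? λ e → all? λ f → e ∈? X →-dec f ∈? X →-dec k e ≟ k f →-dec e ≟ f

∣image∣ : ∀ {m p} (k : Fin m → Fin p) X → InjectiveOn k X → ∣ image k X ∣ ≡ ∣ X ∣
∣image∣ {p = p} k [] inj = ∣⊥∣≡0 p
∣image∣ k (inside ∷ X) inj = trans
  (∣⁅x⁆∪p∣ λ i → let e , e∈X , eq = ∈image⁻ (k ∘ suc) X i in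
    Fin.0≢1+n (inj zero (suc e) here (there e∈X) (sym eq)))
  (cong suc (∣image∣ (k ∘ suc) X λ e f i j eq → Fin.suc-injective (inj (suc e) (suc f) (there i) (there j) eq)))
∣image∣ k (outside ∷ X) inj =
  ∣image∣ (k ∘ suc) X λ e f i j eq → Fin.suc-injective (inj (suc e) (suc f) (there i) (there j) eq)

-- The partition matroid whose blocks are the fibres of `k`.
partition : ∀ {m p} → (Fin m → Fin p) → Family m
partition k X = does (InjectiveOn? k X)

module _ {m p : ℕ} (k : Fin m → Fin p) where

  partition⁺ : ∀ {X} → InjectiveOn k X → X ∈F partition k
  partition⁺ {X} = dec-true (InjectiveOn? k X)

  partition⁻ : ∀ {X} → X ∈F partition k → InjectiveOn k X
  partition⁻ {X} = does⁻ (InjectiveOn? k X)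

  -- If `X` missed a block that `S` meets, an element of that block could be added. So all maximal
  -- sets have one element for each block met by `S`.
  maximal-image : ∀ {S X} → MaximalIn (partition k) S X → image k X ≡ image k S
  maximal-image {S} {X} (X⊆S , XF , max) = ⊆-antisym
    (λ {v} i → let e , e∈X , eq = ∈image⁻ k X i in subst (_∈ image k S) eq (∈image⁺ k (X⊆S e∈X)))
    (λ {v} i → let e , e∈S , eq = ∈image⁻ k S i in subst (_∈ image k X) eq (hit e e∈S))
    where
    hit : ∀ a → a ∈ S → k a ∈ image k X
    hit a a∈S with any? (λ e → e ∈? X ×-dec k e ≟ k a)
    ... | yes (e , e∈X , eq) = subst (_∈ image k X) eq (∈image⁺ k e∈X)
    ... | no none = ∈image⁺ k (subst (a ∈_) X∪a≡X (x∈p∪q⁺ (inj₂ (x∈⁅x⁆ a))))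
      where
      split : ∀ {e} → e ∈ X ∪ ⁅ a ⁆ → e ∈ X ⊎ e ≡ a
      split i = Sum.map₂ (x∈⁅y⁆⇒x≡y a) (x∈p∪q⁻ X ⁅ a ⁆ i)
      inj : InjectiveOn k (X ∪ ⁅ a ⁆)
      inj e f i j eq with split i | split j
      ... | inj₁ i' | inj₁ j' = partition⁻ XF e f i' j' eq
      ... | inj₁ i' | inj₂ refl = ⊥-elim (none (e , i' , eq))
      ... | inj₂ refl | inj₁ j' = ⊥-elim (none (f , j' , sym eq))
      ... | inj₂ refl | inj₂ refl = refl
      ⊆S : X ∪ ⁅ a ⁆ ⊆ S
      ⊆S i with split i
      ... | inj₁ i' = X⊆S i'
      ... | inj₂ refl = a∈S
      X∪a≡X = max (X ∪ ⁅ a ⁆) (p⊆p∪q ⁅ a ⁆) ⊆S (partition⁺ inj)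

  partition-matroid : IsMatroid (partition k)
  partition-matroid = partition⁺ (λ e f i → ⊥-elim (∉⊥ i))
    , (λ X Y XF Y⊆X → partition⁺ λ e f i j → partition⁻ XF e f (Y⊆X i) (Y⊆X j))
    , λ S X Y mx my → trans (size mx) (sym (size my))
    where
    size : ∀ {S X} → MaximalIn (partition k) S X → ∣ X ∣ ≡ ∣ image k S ∣
    size {S} {X} mx@(_ , XF , _) = trans (sym (∣image∣ k X (partition⁻ XF))) (cong ∣_∣ (maximal-image mx))

-- Five dictators and ten two-out-of-three majorities.
weights₅ : Vec (Vec ℕ 5) 15
weights₅ =
  (1 ∷ 0 ∷ 0 ∷ 0 ∷ 0 ∷ []) ∷ (0 ∷ 1 ∷ 0 ∷ 0 ∷ 0 ∷ []) ∷ (0 ∷ 0 ∷ 1 ∷ 0 ∷ 0 ∷ []) ∷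
  (0 ∷ 0 ∷ 0 ∷ 1 ∷ 0 ∷ []) ∷ (0 ∷ 0 ∷ 0 ∷ 0 ∷ 1 ∷ []) ∷
  (1 ∷ 1 ∷ 1 ∷ 0 ∷ 0 ∷ []) ∷ (1 ∷ 1 ∷ 0 ∷ 1 ∷ 0 ∷ []) ∷ (1 ∷ 1 ∷ 0 ∷ 0 ∷ 1 ∷ []) ∷
  (1 ∷ 0 ∷ 1 ∷ 1 ∷ 0 ∷ []) ∷ (1 ∷ 0 ∷ 1 ∷ 0 ∷ 1 ∷ []) ∷ (1 ∷ 0 ∷ 0 ∷ 1 ∷ 1 ∷ []) ∷
  (0 ∷ 1 ∷ 1 ∷ 1 ∷ 0 ∷ []) ∷ (0 ∷ 1 ∷ 1 ∷ 0 ∷ 1 ∷ []) ∷ (0 ∷ 1 ∷ 0 ∷ 1 ∷ 1 ∷ []) ∷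
  (0 ∷ 0 ∷ 1 ∷ 1 ∷ 1 ∷ []) ∷ []

abstract
  Wins₅-meets : ∀ a X → Wins (lookup weights₅ a) X → ∀ Y → Wins (lookup weights₅ a) Y → Meets X Y
  Wins₅-meets = toWitness {a? = all? λ a → ∀⊆? λ X → Wins? (lookup weights₅ a) X →-dec
    ∀⊆? λ Y → Wins? (lookup weights₅ a) Y →-dec Meets? X Y} _

  -- The total weights are odd, so exactly one of `X` and `∁ X` wins; a set on which two different
  -- families disagree, or its complement, separates them.
  separate₅ : ∀ a b → a ≢ b → ∃ λ X → Wins (lookup weights₅ a) X × Wins (lookup weights₅ b) (∁ X)
  separate₅ = toWitness {a? = all? λ a → all? λ b → ¬? (a ≟ b) →-dec
    anySubset? λ X → Wins? (lookup weights₅ a) X ×-dec Wins? (lookup weights₅ b) (∁ X)} _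

-- Five matroids for at most fifteen vertices

module Upper (G : Graph) (nv≤15 : nv G ≤ 15) where

  private
    φ : Fin (nv G) → Fin 15
    φ v = inject≤ v nv≤15

    separation : ∀ e → ∃ λ X → Wins (lookup weights₅ (φ (src G e))) X × Wins (lookup weights₅ (φ (tgt G e))) (∁ X)
    separation e = separate₅ (φ (src G e)) (φ (tgt G e)) λ eq → loopless G e (inject≤-injective nv≤15 nv≤15 _ _ eq)

    -- The star to which partition `i` assigns `e`. The separating set makes the partitions centred
    -- at either end a winning set for the family of that end.
    centre : Fin 5 → Fin (ne G) → Fin (nv G)
    centre i e with i ∈? proj₁ (separation e)
    ... | yes _ = src G e
    ... | no _ = tgt G e

    centre-incident : ∀ i e → Incident G (centre i e) e
    centre-incident i e with i ∈? proj₁ (separation e)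
    ... | yes _ = inj₁ refl
    ... | no _ = inj₂ refl

    winning : ∀ {v e} → Incident G v e → ∃ λ X → Wins (lookup weights₅ (φ v)) X × (∀ {i} → i ∈ X → centre i e ≡ v)
    winning {e = e} (inj₁ refl) = proj₁ (separation e) , proj₁ (proj₂ (separation e)) , towards
      where
      towards : ∀ {i} → i ∈ proj₁ (separation e) → centre i e ≡ src G e
      towards {i} m with i ∈? proj₁ (separation e)
      ... | yes _ = refl
      ... | no ∉X = ⊥-elim (∉X m)
    winning {e = e} (inj₂ refl) = ∁ (proj₁ (separation e)) , proj₂ (proj₂ (separation e)) , towards
      where
      towards : ∀ {i} → i ∈ ∁ (proj₁ (separation e)) → centre i e ≡ tgt G e
      towards {i} m with i ∈? proj₁ (separation e)
      ... | yes ∈X = ⊥-elim (x∈∁p⇒x∉p m ∈X)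
      ... | no _ = refl

    -- Both edges are centred at `v` on sets that win in the family of `v`, and any two winning sets
    -- meet.
    common-centre : ∀ {v e f} → Incident G v e → Incident G v f → ∃ λ i → centre i e ≡ centre i f
    common-centre {v} ie jf =
      let X , wX , toX = winning ie
          Y , wY , toY = winning jf
          i , i∈X , i∈Y = Wins₅-meets (φ v) X wX Y wY
      in i , trans (toX i∈X) (sym (toY i∈Y))

  five-matroids : IntersectionOf G 5
  five-matroids = partition ∘ centre , partition-matroid ∘ centre , λ X → mk⇔
    (λ mt i → partition⁺ (centre i) λ e f e∈X f∈X eq → decidable-stable (e ≟ f) λ e≢f →
      mt e f e∈X f∈X e≢f (centre i e) (centre-incident i e , subst (λ v → Incident G v f) (sym eq) (centre-incident i f)))
    (λ all e f e∈X f∈X e≢f v (ie , jf) → let i , eq = common-centre ie jf in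
      e≢f (partition⁻ (centre i) (all i) e f e∈X f∈X eq))

theorem8 : ∀ (n : ℕ) → 13 ≤ n → n ≤ 15 → MuIs n 5
theorem8 n 13≤n n≤15 =
  -- One graph serves all three values of `n`, since thirteen vertices already outnumber the twelve
  -- families on four points.
  (K 13 , 13≤n , Upper.five-matroids (K 13) (ℕ.m≤m+n 13 2) , λ j j<5 → K-lower (ℕ.≤-refl {13}) (ℕ.s≤s⁻¹ j<5)) ,
  λ G nv≤n j (_ , least) → ℕ.≮⇒≥ λ 5<j → least 5 5<j (Upper.five-matroids G (ℕ.≤-trans nv≤n n≤15))
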